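{- There is an absolute constant $c>0$ such that the following holds. Let $t<n$ be positive integers with $t\mid n$, let $f\colon\{0,1\}^t\to\{ -1,1\}$ with $d=\deg(f)$, and let $F$ be the $(n,t,f)$-pattern matrix. Then \[ \mathrm{rk}F\ge\left(\frac nt\right)^d\ge\exp\{c\,D(F)^{1/4}\}. \]
   Context: $\deg(f)=\max\{|S|:\hat f(S)\ne0\}$ where $\hat f(S)=2^{ -t}\sum_z f(z)(-1)^{\sum_{i\in S}z_i}$ (equivalently the degree of the unique multilinear real polynomial representing $f$). Pattern matrix: partition $[n]$ into $t$ contiguous blocks of size $n/t$; $\mathcal V(n,t)$ is the family of sets with exactly one element per block; $x|_V=(x_{i_1},\dots,x_{i_t})$ for $V=\{i_1<\dots<i_t\}$; the $(n,t,f)$-pattern matrix has rows $x\in\{0,1\}^n$, columns $(V,w)\in\mathcal V(n,t)\times\{0,1\}^t$, entries $f(x|_V\oplus w)$. $D(F)$ is the deterministic two-party communication complexity of the function $(x,(V,w))\mapsto F_{x,(V,w)}$. -}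

module Defs where

open import Data.Bool using (Bool; true; false; _∧_; _xor_; if_then_else_)
open import Data.Nat as ℕ using (ℕ; zero; suc)
open import Data.Nat.Properties using (m^n≢0)
open import Data.Fin using (Fin; combine; cast)
open import Data.Fin.Subset using (Subset; ∣_∣)
open import Data.Vec using (Vec; []; _∷_; lookup; tabulate; zipWith)
open import Data.List as L using (List; _++_)
open import Data.Integer as ℤ using (ℤ; +_)
open import Data.Rational as ℚ using (ℚ; 0ℚ; 1ℚ)
open import Data.Product using (Σ; _×_; _,_)
open import Relation.Binary.PropositionalEquality using (_≡_; _≢_)

allBits : (t : ℕ) → List (Vec Bool t)
allBits zero = [] L.∷ L.[]
allBits (suc t) = L.map (false ∷_) (allBits t) ++ L.map (true ∷_) (allBits t)

parity : ∀ {t} → Subset t → Vec Bool t → Bool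
parity [] [] = false
parity (s ∷ S) (z ∷ zs) = (s ∧ z) xor parity S zs

chi : ∀ {t} → Subset t → Vec Bool t → ℤ
chi S z = if parity S z then ℤ.-[1+ 0 ] else + 1

sumℤ : List ℤ → ℤ
sumℤ = L.foldr ℤ._+_ (+ 0)

fhat : ∀ {t} → (Vec Bool t → ℤ) → Subset t → ℚ
fhat {t} f S =
  ℚ._/_ (sumℤ (L.map (λ z → f z ℤ.* chi S z) (allBits t))) (2 ℕ.^ t) {{m^n≢0 2 t}}

IsDegree : ∀ {t} → (Vec Bool t → ℤ) → ℕ → Set
IsDegree {t} f d =
  (Σ (Subset t) λ S → (∣ S ∣ ≡ d) × (fhat f S ≢ 0ℚ))
  × ((S : Subset t) → fhat f S ≢ 0ℚ → ∣ S ∣ ℕ.≤ d)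

-- A set V ∈ 𝒱(n,t) is encoded by V : Vec (Fin m) t, where m = n/t is the
-- block size and V[i] is the offset of the chosen element inside block i
-- (block i = {i*m, …, i*m+m-1}).  x|_V = (x_{i*m + V[i]})_i.
restrict : ∀ {n t m} → t ℕ.* m ≡ n → Vec Bool n → Vec (Fin m) t → Vec Bool t
restrict eq x V = tabulate λ i → lookup x (cast eq (combine i (lookup V i)))

Column : ℕ → ℕ → Set
Column t m = Vec (Fin m) t × Vec Bool t

patternMatrix : ∀ {n t m} → t ℕ.* m ≡ n → (Vec Bool t → ℤ) →
                Vec Bool n → Column t m → ℤ
patternMatrix eq f x (V , w) = f (zipWith _xor_ (restrict eq x V) w)

-- rank (over ℚ, i.e. over ℝ, since entries are integers)
sumFinℚ : (k : ℕ) → (Fin k → ℚ) → ℚ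
sumFinℚ zero g = 0ℚ
sumFinℚ (suc k) g = g Fin.zero ℚ.+ sumFinℚ k (λ j → g (Fin.suc j))
  where import Data.Fin as Fin

toℚ : ℤ → ℚ
toℚ z = ℚ._/_ z 1

RankAtLeast : ∀ {R C : Set} → (R → C → ℤ) → ℕ → Set
RankAtLeast {R} {C} M k =
  Σ (Fin k → R) λ rows →
    (a : Fin k → ℚ) →
    ((c : C) → sumFinℚ k (λ j → a j ℚ.* toℚ (M (rows j) c)) ≡ 0ℚ) →
    (j : Fin k) → a j ≡ 0ℚ

data Protocol (X Y O : Set) : Set where
  leaf  : O → Protocol X Y O
  alice : (X → Bool) → Protocol X Y O → Protocol X Y O → Protocol X Y O
  bob   : (Y → Bool) → Protocol X Y O → Protocol X Y O → Protocol X Y O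

run : ∀ {X Y O} → Protocol X Y O → X → Y → O
run (leaf o) x y = o
run (alice a p q) x y = if a x then run p x y else run q x y
run (bob b p q) x y = if b y then run p x y else run q x y

depth : ∀ {X Y O} → Protocol X Y O → ℕ
depth (leaf o) = 0
depth (alice a p q) = suc (depth p ℕ.⊔ depth q)
depth (bob b p q) = suc (depth p ℕ.⊔ depth q)

Computes : ∀ {X Y O} → Protocol X Y O → (X → Y → O) → Set
Computes {X} {Y} P F = (x : X) (y : Y) → run P x y ≡ F x y

IsCC : ∀ {X Y O} → (X → Y → O) → ℕ → Set
IsCC {X} {Y} {O} F D =
  (Σ (Protocol X Y O) λ P → Computes P F × (depth P ≡ D))
  × ((P : Protocol X Y O) → Computes P F → D ℕ.≤ depth P)

expPartial : ℚ → ℕ → ℚ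
expPartial q N = go N 1ℚ 0
  where
  go : ℕ → ℚ → ℕ → ℚ      -- go r term k : sum of r terms starting at q^k/k!
  go zero term k = 0ℚ
  go (suc r) term k = term ℚ.+ go r (term ℚ.* q ℚ.* ℚ._/_ (+ 1) (suc k)) (suc k)

-- exp(c · D^{1/4}) ≤ M, for c ≥ 0.
-- Since exp is continuous and increasing and the rationals are dense,
-- exp(y) ≤ M iff for every rational 0 ≤ q ≤ y and every N, Σ_{k<N} q^k/k! ≤ M;
-- and 0 ≤ q ≤ c·D^{1/4} iff 0 ≤ q and q^4 ≤ c^4 · D.
ExpLe : ℚ → ℕ → ℕ → Set
ExpLe c D M =
  (q : ℚ) → 0ℚ ℚ.≤ q →
  q ℚ.* q ℚ.* q ℚ.* q ℚ.≤ c ℚ.* c ℚ.* c ℚ.* c ℚ.* toℚ (+ D) →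
  (N : ℕ) → expPartial q N ℚ.≤ toℚ (+ M)

-- Averaging against χ_S(w) turns the row x of F into the multiple f̂(S) χ_S(x|_V),
-- so for |S| = d with f̂(S) ≠ 0 it suffices to exhibit m^d inputs x on which the
-- functions V ↦ χ_S(x|_V) are independent; this is the d-th Kronecker power of a
-- nonsingular m × m sign matrix.
--
-- For the communication bound, f has a decision tree of depth O(d⁴) (Nisan and
-- Smolensky): in each round query a maximal disjoint family of sets S with |S| = d
-- and f̂(S) ≠ 0, after which the degree has dropped.  Each such set contains a block
-- to which f is sensitive at 0, and by Markov's inequality at an endpoint of the
-- interval there are at most 4d² disjoint sensitive blocks.  Each query to
-- x|_V ⊕ w costs O(log m) bits.
module Submission where

open import Defs
open import Data.Bool using (Bool; true; false; _∧_; _xor_; if_then_else_)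
open import Data.Bool.Properties using (xor-identityʳ)
open import Data.Fin as Fin using (Fin; zero; suc; combine; remQuot; cast; toℕ; fromℕ<; _↑ˡ_; _↑ʳ_)
import Data.Fin.Properties as Fin
open import Data.Fin.Subset using (Subset; ⊥; ∣_∣; _∩_; _∪_; ⋃; inside; outside)
open import Data.Fin.Subset.Properties using (anySubset?; ∣⊥∣≡0; ∣p∩q∣≤∣p∣)
open import Data.Integer as ℤ using (ℤ; +_; -[1+_]; 0ℤ; 1ℤ; -1ℤ)
open import Data.Integer.GCD using (gcd)
import Data.Integer.Properties as ℤ
open import Data.Integer.Tactic.RingSolver using (solve-∀)
open import Data.List as L using (List; []; _∷_; _++_; length)
import Data.List.Properties as L
open import Data.List.Relation.Unary.All using (All; []; _∷_)
import Data.List.Relation.Unary.All.Properties as All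
open import Data.Nat as ℕ using (ℕ; zero; suc; z≤n; s≤s; _<?_)
open import Data.Nat.Combinatorics using (_C_; nCk+nC[k+1]≡[n+1]C[k+1]; k>n⇒nCk≡0)
import Data.Nat.Properties as ℕ
import Data.Nat.Tactic.RingSolver as ℕ-Solver
open import Data.Product using (Σ; ∃; _×_; _,_; proj₁; proj₂)
open import Data.Rational as ℚ using (ℚ; 0ℚ; 1ℚ; ½; ↥_)
import Data.Rational.Properties as ℚ
open import Data.Rational.Solver using (module +-*-Solver)
import Data.Rational.Unnormalised as ℚᵘ
import Data.Rational.Unnormalised.Properties as ℚᵘ
open import Data.Sum using (_⊎_; inj₁; inj₂)
open import Data.Vec as V using (Vec; []; _∷_; lookup; tabulate; zipWith; _[_]≔_)
import Data.Vec.Properties as V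
open import Function using (_∘_)
open import Relation.Binary.PropositionalEquality
open import Relation.Nullary using (yes; no; does; ofʸ; ofⁿ; contradiction; ¬?; _×-dec_)
open import Relation.Nullary.Decidable using (decidable-stable)

-- Markov's inequality is used in a finite form over the integers. Let p(u) be the expectation of f
-- when each block is flipped with probability u. Its degree is at most d, it is bounded by 1 on
-- [0,1], and it is sampled at u = i²/d², points that cluster at 0 like Chebyshev nodes. With i = j
-- - d running through both signs, (p(u) - p(0))/u is a polynomial in j of degree below 2d, so its
-- difference of order 2d expresses the value p'(0) at the centre through the other samples. These
-- are at most 2/u in size and the sum of 1/i² is at most 2, so |p'(0)| ≤ 8d². Every sensitive block
-- contributes 2 to |p'(0)|, which leaves at most 4d² blocks.
--
-- Each leading set has d elements, so a round costs 4d³ queries and the tree has depth at most 4d⁴.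
-- The cost of a query is rounded up to 4ℓ⁴, with ℓ the integer part of log m: the fourth root then
-- turns 16(dℓ)⁴ into 2dℓ, while m^d ≥ 2^(dℓ). The factor c = 1/4 leaves exp(dℓ/2) ≤ 2^(dℓ).

private variable
  t m n : ℕ
  X Y O : Set

module _ where

  open import Data.Integer using (_+_; _*_; -_; _-_)

  -- Fourier coefficients

  BoolFn : ℕ → Set
  BoolFn t = Vec Bool t → ℤ

  sgn : Bool → ℤ
  sgn b = if b then -1ℤ else 1ℤ

  sgn-xor : ∀ a b → sgn (a xor b) ≡ sgn a * sgn b
  sgn-xor false false = refl
  sgn-xor false true  = refl
  sgn-xor true  false = refl
  sgn-xor true  true  = refl

  _⊕_ : Vec Bool t → Vec Bool t → Vec Bool t
  _⊕_ = zipWith _xor_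

  -- The unnormalised coefficient `2^t · fhat f S`, computed one coordinate at a time as in the fast
  -- Walsh-Hadamard transform. It stays in ℤ and suits induction on the coordinates.
  coeff : BoolFn t → Subset t → ℤ
  coeff f []      = f []
  coeff f (s ∷ S) = coeff (f ∘ (false ∷_)) S + sgn s * coeff (f ∘ (true ∷_)) S

  coeff-linear : ∀ a (f g : BoolFn t) S →
                 coeff (λ z → f z + a * g z) S ≡ coeff f S + a * coeff g S
  coeff-linear a f g []      = refl
  coeff-linear a f g (s ∷ S) = begin
    _ ≡⟨ cong₂ (λ p q → p + sgn s * q) (coeff-linear a _ _ S) (coeff-linear a _ _ S) ⟩
    _ ≡⟨ rearrange (coeff (f ∘ (false ∷_)) S) (coeff (g ∘ (false ∷_)) S)
                   (coeff (f ∘ (true ∷_)) S) (coeff (g ∘ (true ∷_)) S) a (sgn s) ⟩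
    _ ∎
    where
    open ≡-Reasoning
    rearrange : ∀ p q r u a s → (p + a * q) + s * (r + a * u) ≡ (p + s * r) + a * (q + s * u)
    rearrange = solve-∀

  sumℤ-++ : ∀ xs ys → sumℤ (xs ++ ys) ≡ sumℤ xs + sumℤ ys
  sumℤ-++ []       ys = sym (ℤ.+-identityˡ _)
  sumℤ-++ (x ∷ xs) ys = trans (cong (λ r → x + r) (sumℤ-++ xs ys)) (sym (ℤ.+-assoc x _ _))

  sumℤ-map-* : ∀ {A : Set} a (g : A → ℤ) xs → sumℤ (L.map (λ x → a * g x) xs) ≡ a * sumℤ (L.map g xs)
  sumℤ-map-* a g []       = sym (ℤ.*-zeroʳ a)
  sumℤ-map-* a g (x ∷ xs) =
    trans (cong (λ r → a * g x + r) (sumℤ-map-* a g xs)) (sym (ℤ.*-distribˡ-+ a _ _))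

  coeff-sum : (f : BoolFn t) (S : Subset t) →
              sumℤ (L.map (λ z → f z * chi S z) (allBits t)) ≡ coeff f S
  coeff-sum f []      = trans (ℤ.+-identityʳ _) (ℤ.*-identityʳ _)
  coeff-sum {suc t} f (s ∷ S) = begin
    sumℤ (L.map h (L.map (false ∷_) zs ++ L.map (true ∷_) zs))
      ≡⟨ cong sumℤ (L.map-++ h (L.map (false ∷_) zs) _) ⟩
    sumℤ (L.map h (L.map (false ∷_) zs) ++ L.map h (L.map (true ∷_) zs))
      ≡⟨ sumℤ-++ (L.map h (L.map (false ∷_) zs)) _ ⟩
    sumℤ (L.map h (L.map (false ∷_) zs)) + sumℤ (L.map h (L.map (true ∷_) zs))
      ≡⟨ cong₂ _+_ (half false) (half true) ⟩
    1ℤ * coeff (f ∘ (false ∷_)) S + sgn s * coeff (f ∘ (true ∷_)) S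
      ≡⟨ cong (_+ sgn s * coeff (f ∘ (true ∷_)) S) (ℤ.*-identityˡ (coeff (f ∘ (false ∷_)) S)) ⟩
    coeff f (s ∷ S) ∎
    where
    open ≡-Reasoning
    zs = allBits t
    h = λ z → f z * chi (s ∷ S) z
    ∧-sgn : ∀ s b → sgn (s ∧ b) ≡ (if b then sgn s else 1ℤ)
    ∧-sgn false false = refl
    ∧-sgn false true  = refl
    ∧-sgn true  false = refl
    ∧-sgn true  true  = refl
    swap : ∀ a b c → a * (b * c) ≡ b * (a * c)
    swap = solve-∀
    half : ∀ b → sumℤ (L.map h (L.map (b ∷_) zs)) ≡ (if b then sgn s else 1ℤ) * coeff (f ∘ (b ∷_)) S
    half b = begin
      sumℤ (L.map h (L.map (b ∷_) zs)) ≡⟨ cong sumℤ (L.map-∘ zs) ⟨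
      sumℤ (L.map (h ∘ (b ∷_)) zs)
        ≡⟨ cong sumℤ (L.map-cong (λ z → trans (cong (f (b ∷ z) *_)
             (trans (sgn-xor (s ∧ b) (parity S z)) (cong (_* chi S z) (∧-sgn s b))))
             (swap (f (b ∷ z)) (if b then sgn s else 1ℤ) (chi S z))) zs) ⟩
      sumℤ (L.map (λ z → (if b then sgn s else 1ℤ) * (f (b ∷ z) * chi S z)) zs)
        ≡⟨ sumℤ-map-* (if b then sgn s else 1ℤ) (λ z → f (b ∷ z) * chi S z) zs ⟩
      (if b then sgn s else 1ℤ) * sumℤ (L.map (λ z → f (b ∷ z) * chi S z) zs)
        ≡⟨ cong ((if b then sgn s else 1ℤ) *_) (coeff-sum (f ∘ (b ∷_)) S) ⟩
      (if b then sgn s else 1ℤ) * coeff (f ∘ (b ∷_)) S ∎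

  -- Flipping one coordinate swaps the two halves p and q, and q + s p = s (p + s q) for a sign s.
  -- The identity serves both the rank bound and the analysis of block flips.
  coeff-shift : (f : BoolFn t) (y : Vec Bool t) (S : Subset t) →
                coeff (λ z → f (y ⊕ z)) S ≡ chi S y * coeff f S
  coeff-shift f []      []      = sym (ℤ.*-identityˡ _)
  coeff-shift f (b ∷ y) (s ∷ S)
    rewrite coeff-shift (f ∘ ((b xor false) ∷_)) y S | coeff-shift (f ∘ ((b xor true) ∷_)) y S
          | sgn-xor (s ∧ b) (parity S y)
    = go s b
    where
    c₀ = coeff (f ∘ (false ∷_)) S
    c₁ = coeff (f ∘ (true ∷_)) S
    flip₊ : ∀ x p q → x * q + 1ℤ * (x * p) ≡ 1ℤ * x * (p + 1ℤ * q)
    flip₊ = solve-∀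
    flip₋ : ∀ x p q → x * q + -1ℤ * (x * p) ≡ -1ℤ * x * (p + -1ℤ * q)
    flip₋ = solve-∀
    keep : ∀ x p q s → x * p + s * (x * q) ≡ 1ℤ * x * (p + s * q)
    keep = solve-∀
    go : ∀ s b → chi S y * coeff (f ∘ ((b xor false) ∷_)) S + sgn s * (chi S y * coeff (f ∘ ((b xor true) ∷_)) S)
               ≡ sgn (s ∧ b) * chi S y * (c₀ + sgn s * c₁)
    go false false = keep (chi S y) c₀ c₁ 1ℤ
    go true  false = keep (chi S y) c₀ c₁ -1ℤ
    go false true  = flip₊ (chi S y) c₀ c₁
    go true  true  = flip₋ (chi S y) c₀ c₁

  double≡0 : ∀ a → a + a ≡ 0ℤ → a ≡ 0ℤ
  double≡0 a eq = ℤ.*-cancelˡ-≡ (+ 2) a 0ℤ (trans (twice a) eq)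
    where
    twice : ∀ a → + 2 * a ≡ a + a
    twice = solve-∀

  -- The two coefficients are p + q and p - q, where p and q belong to the two faces; their sum and
  -- difference recover 2p and 2q.
  coeff-face : (f : BoolFn (suc t)) → ∀ b (S : Subset t) →
               coeff f (outside ∷ S) ≡ 0ℤ → coeff f (inside ∷ S) ≡ 0ℤ →
               coeff (f ∘ (b ∷_)) S ≡ 0ℤ
  coeff-face f b S out in′ = go b
    where
    p = coeff (f ∘ (false ∷_)) S
    q = coeff (f ∘ (true ∷_)) S
    add : ∀ p q → p + p ≡ (p + 1ℤ * q) + (p + -1ℤ * q)
    add = solve-∀
    sub : ∀ p q → q + q ≡ (p + 1ℤ * q) + - (p + -1ℤ * q)
    sub = solve-∀
    go : ∀ b → coeff (f ∘ (b ∷_)) S ≡ 0ℤ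
    go false = double≡0 p (trans (add p q) (cong₂ _+_ out in′))
    go true  = double≡0 q (trans (sub p q) (cong₂ (λ a b → a + - b) out in′))

  coeff≡0⇒≡0 : (f : BoolFn t) → (∀ S → coeff f S ≡ 0ℤ) → ∀ z → f z ≡ 0ℤ
  coeff≡0⇒≡0 f h []      = h []
  coeff≡0⇒≡0 f h (b ∷ z) =
    coeff≡0⇒≡0 (f ∘ (b ∷_)) (λ S → coeff-face f b S (h (outside ∷ S)) (h (inside ∷ S))) z

  -- Polynomial sequences and their central differences

  -- Polynomials of degree below n, described by the vanishing of the n-th forward difference, so
  -- that no coefficients are handled.
  Poly : ℕ → (ℕ → ℤ) → Set
  Poly zero    g = ∀ j → g j ≡ 0ℤ
  Poly (suc n) g = Poly n (λ j → g (suc j) - g j)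

  Poly-cong : ∀ n {g h} → (∀ j → g j ≡ h j) → Poly n g → Poly n h
  Poly-cong zero    eq p j = trans (sym (eq j)) (p j)
  Poly-cong (suc n) eq p   = Poly-cong n (λ j → cong₂ _-_ (eq (suc j)) (eq j)) p

  Poly-+ : ∀ n g h → Poly n g → Poly n h → Poly n (λ j → g j + h j)
  Poly-+ zero    g h p q j = cong₂ _+_ (p j) (q j)
  Poly-+ (suc n) g h p q   =
    Poly-cong n (λ j → rearrange (g (suc j)) (g j) (h (suc j)) (h j)) (Poly-+ n _ _ p q)
    where
    rearrange : ∀ a b c d → (a + - b) + (c + - d) ≡ (a + c) + - (b + d)
    rearrange = solve-∀

  Poly-* : ∀ n a g → Poly n g → Poly n (λ j → a * g j)
  Poly-* zero    a g p j = trans (cong (a *_) (p j)) (ℤ.*-zeroʳ a)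
  Poly-* (suc n) a g p   = Poly-cong n (λ j → distrib a (g (suc j)) (g j)) (Poly-* n a _ p)
    where
    distrib : ∀ a b c → a * (b + - c) ≡ a * b + - (a * c)
    distrib = solve-∀

  Poly-weaken : ∀ n g → Poly n g → Poly (suc n) g
  Poly-weaken zero    g p j = cong₂ _-_ (p (suc j)) (p j)
  Poly-weaken (suc n) g p   = Poly-weaken n _ p

  Poly-const : ∀ n a → Poly (suc n) (λ _ → a)
  Poly-const zero    a j = ℤ.+-inverseʳ a
  Poly-const (suc n) a   = Poly-weaken (suc n) (λ _ → a) (Poly-const n a)

  Poly-shift : ∀ n g → Poly n g → Poly n (g ∘ suc)
  Poly-shift zero    g p j = p (suc j)
  Poly-shift (suc n) g p   = Poly-shift n _ p

  -- Discrete product rule: the difference of (j - c) g(j) is (j - c) times the difference of g,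
  -- plus g(j + 1).
  Poly-linear : ∀ n c g → Poly n g → Poly (suc n) (λ j → (+ j - c) * g j)
  Poly-linear zero    c g p j rewrite p j | p (suc j) = zeros (+ suc j + - c) (+ j + - c)
    where
    zeros : ∀ a b → a * 0ℤ + - (b * 0ℤ) ≡ 0ℤ
    zeros = solve-∀
  Poly-linear (suc n) c g p =
    Poly-cong (suc n) (λ j → leibniz (+ j) c (g (suc j)) (g j))
      (Poly-+ (suc n) (λ j → (+ j - c) * (g (suc j) - g j)) (g ∘ suc)
        (Poly-linear n c _ p) (Poly-shift (suc n) g p))
    where
    leibniz : ∀ j c x y → (j + - c) * (x + - y) + x ≡ (1ℤ + j + - c) * x + - ((j + - c) * y)
    leibniz = solve-∀

  altSum : ℕ → (ℕ → ℤ) → ℤ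
  altSum zero    h = 0ℤ
  altSum (suc k) h = h 0 - altSum k (h ∘ suc)

  altSum-cong : ∀ k {g h} → (∀ j → g j ≡ h j) → altSum k g ≡ altSum k h
  altSum-cong zero    eq = refl
  altSum-cong (suc k) eq = cong₂ _-_ (eq 0) (altSum-cong k (eq ∘ suc))

  altSum-+ : ∀ k g h → altSum k (λ j → g j + h j) ≡ altSum k g + altSum k h
  altSum-+ zero    g h = refl
  altSum-+ (suc k) g h = trans (cong (λ s → g 0 + h 0 - s) (altSum-+ k (g ∘ suc) (h ∘ suc)))
    (rearrange (g 0) (h 0) (altSum k (g ∘ suc)) (altSum k (h ∘ suc)))
    where
    rearrange : ∀ a b c d → (a + b) + - (c + d) ≡ (a + - c) + (b + - d)
    rearrange = solve-∀

  altSum-neg : ∀ k h → altSum k (λ j → - h j) ≡ - altSum k h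
  altSum-neg zero    h = refl
  altSum-neg (suc k) h = trans (cong (λ s → - h 0 - s) (altSum-neg k (h ∘ suc))) (distrib (h 0) (altSum k (h ∘ suc)))
    where
    distrib : ∀ a b → - a + - (- b) ≡ - (a + - b)
    distrib = solve-∀

  altSum-zero : ∀ k {h} → (∀ j → h j ≡ 0ℤ) → altSum k h ≡ 0ℤ
  altSum-zero zero    p = refl
  altSum-zero (suc k) p = cong₂ _-_ (p 0) (altSum-zero k (p ∘ suc))

  -- Up to sign the sum is the n-th difference of g at 0: Pascal's rule reduces order n + 1 for g to
  -- order n for its difference. Any number k > n of terms is allowed, since the binomials past n
  -- vanish.
  binomial-altSum : ∀ n {k} g → n ℕ.< k → Poly n g → altSum k (λ j → + (n C j) * g j) ≡ 0ℤ
  binomial-altSum zero    {suc k} g _ p = altSum-zero (suc k) λ j →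
    trans (cong (+ (0 C j) *_) (p j)) (ℤ.*-zeroʳ (+ (0 C j)))
  binomial-altSum (suc n) {suc k} g (s≤s n<k) p = begin
    h 0 - altSum k (λ j → + (suc n C suc j) * g (suc j))
      ≡⟨ cong (λ s → h 0 - s) (altSum-cong k pascal) ⟩
    h 0 - altSum k (λ j → h (suc j) + h′ j)
      ≡⟨ cong (λ s → h 0 - s) (altSum-+ k (h ∘ suc) h′) ⟩
    h 0 - (altSum k (h ∘ suc) + altSum k h′)
      ≡⟨ regroup (h 0) (altSum k (h ∘ suc)) (altSum k h′) ⟩
    altSum (suc k) h - altSum k h′
      ≡⟨ cong (λ s → s - altSum k h′) snoc ⟩
    altSum k h - altSum k h′
      ≡⟨ trans (cong (λ s → s - altSum k h′) (sym (ℤ.neg-involutive (altSum k h)))) (flip (altSum k h) (altSum k h′)) ⟩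
    - (altSum k h′ + - altSum k h)
      ≡⟨ cong (λ s → - (altSum k h′ + s)) (altSum-neg k h) ⟨
    - (altSum k h′ + altSum k (λ j → - h j))
      ≡⟨ cong -_ (altSum-+ k h′ (λ j → - h j)) ⟨
    - altSum k (λ j → h′ j + - h j)
      ≡⟨ cong -_ (altSum-cong k (λ j → distrib (+ (n C j)) (g (suc j)) (g j))) ⟩
    - altSum k (λ j → + (n C j) * (g (suc j) - g j))
      ≡⟨ cong -_ (binomial-altSum n (λ j → g (suc j) - g j) n<k p) ⟩
    0ℤ ∎
    where
    open ≡-Reasoning
    h h′ : ℕ → ℤ
    h  j = + (n C j) * g j
    h′ j = + (n C j) * g (suc j)
    pascal : ∀ j → + (suc n C suc j) * g (suc j) ≡ h (suc j) + h′ j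
    pascal j = begin
      + (suc n C suc j) * g (suc j)                 ≡⟨ cong (λ c → + c * g (suc j)) (nCk+nC[k+1]≡[n+1]C[k+1] n j) ⟨
      (+ (n C j) + + (n C suc j)) * g (suc j)       ≡⟨ expand (+ (n C j)) (+ (n C suc j)) (g (suc j)) ⟩
      h (suc j) + h′ j                              ∎
      where
      expand : ∀ a b x → (a + b) * x ≡ b * x + a * x
      expand = solve-∀
    regroup : ∀ a b c → a + - (b + c) ≡ (a + - b) + - c
    regroup = solve-∀
    flip : ∀ a b → - (- a) + - b ≡ - (b + - a)
    flip = solve-∀
    distrib : ∀ a b c → a * b + - (a * c) ≡ a * (b + - c)
    distrib = solve-∀
    last≡0 : ∀ k h → (∀ j → k ℕ.≤ j → h j ≡ 0ℤ) → altSum (suc k) h ≡ altSum k h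
    last≡0 zero    h z = cong (λ s → s - 0ℤ) (z 0 z≤n)
    last≡0 (suc k) h z = cong (λ s → h 0 - s) (last≡0 k (h ∘ suc) (λ j k≤j → z (suc j) (s≤s k≤j)))
    -- The extra term carries the weight C(n,k), which is 0 because n < k.
    snoc : altSum (suc k) h ≡ altSum k h
    snoc = last≡0 k h (λ j k≤j → cong (λ c → + c * g j) (k>n⇒nCk≡0 (ℕ.<-≤-trans n<k k≤j)))

  -- The ratio (k+1) C(n,k+1) = (n-k) C(n,k), written without truncated subtraction; comparing n
  -- with 2k + 1 then shows whether the binomials rise or fall.
  absorption : ∀ n k → suc k ℕ.* (n C suc k) ℕ.+ k ℕ.* (n C k) ≡ n ℕ.* (n C k)
  absorption zero zero    = refl
  absorption zero (suc k) = cong₂ ℕ._+_ (ℕ.*-zeroʳ k) (ℕ.*-zeroʳ k)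
  absorption (suc n) zero    = begin
    1 ℕ.* (suc n C 1) ℕ.+ 0 ≡⟨ cong (λ c → 1 ℕ.* c ℕ.+ 0) (nCk+nC[k+1]≡[n+1]C[k+1] n 0) ⟨
    1 ℕ.* (1 ℕ.+ n C 1) ℕ.+ 0 ≡⟨ cong suc (absorption n 0) ⟩
    suc n ℕ.* 1 ∎
    where open ≡-Reasoning
  absorption (suc n) (suc k) = begin
    suc (suc k) ℕ.* (suc n C suc (suc k)) ℕ.+ suc k ℕ.* (suc n C suc k)
      ≡⟨ cong₂ (λ x y → suc (suc k) ℕ.* x ℕ.+ suc k ℕ.* y) (nCk+nC[k+1]≡[n+1]C[k+1] n (suc k)) (nCk+nC[k+1]≡[n+1]C[k+1] n k) ⟨
    suc (suc k) ℕ.* (b ℕ.+ c) ℕ.+ suc k ℕ.* (a ℕ.+ b)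
      ≡⟨ split k a b c ⟩
    (suc (suc k) ℕ.* c ℕ.+ suc k ℕ.* b) ℕ.+ (suc k ℕ.* b ℕ.+ k ℕ.* a) ℕ.+ (a ℕ.+ b)
      ≡⟨ cong₂ (λ x y → x ℕ.+ y ℕ.+ (a ℕ.+ b)) (absorption n (suc k)) (absorption n k) ⟩
    n ℕ.* b ℕ.+ n ℕ.* a ℕ.+ (a ℕ.+ b)
      ≡⟨ join n a b ⟩
    suc n ℕ.* (a ℕ.+ b)
      ≡⟨ cong (suc n ℕ.*_) (nCk+nC[k+1]≡[n+1]C[k+1] n k) ⟩
    suc n ℕ.* (suc n C suc k) ∎
    where
    open ≡-Reasoning
    a = n C k
    b = n C suc k
    c = n C suc (suc k)
    split : ∀ k a b c → suc (suc k) ℕ.* (b ℕ.+ c) ℕ.+ suc k ℕ.* (a ℕ.+ b) ≡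
            (suc (suc k) ℕ.* c ℕ.+ suc k ℕ.* b) ℕ.+ (suc k ℕ.* b ℕ.+ k ℕ.* a) ℕ.+ (a ℕ.+ b)
    split = ℕ-Solver.solve-∀
    join : ∀ n a b → n ℕ.* b ℕ.+ n ℕ.* a ℕ.+ (a ℕ.+ b) ≡ suc n ℕ.* (a ℕ.+ b)
    join = ℕ-Solver.solve-∀

  C-ascending : ∀ n k → suc k ℕ.+ k ℕ.≤ n → n C k ℕ.≤ n C suc k
  C-ascending n k le = ℕ.*-cancelˡ-≤ (suc k) (ℕ.+-cancelʳ-≤ (k ℕ.* (n C k)) _ _ (begin
    suc k ℕ.* (n C k) ℕ.+ k ℕ.* (n C k)     ≡⟨ ℕ.*-distribʳ-+ (n C k) (suc k) k ⟨
    (suc k ℕ.+ k) ℕ.* (n C k)               ≤⟨ ℕ.*-monoˡ-≤ (n C k) le ⟩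
    n ℕ.* (n C k)                           ≡⟨ absorption n k ⟨
    suc k ℕ.* (n C suc k) ℕ.+ k ℕ.* (n C k) ∎))
    where open ℕ.≤-Reasoning

  C-descending : ∀ n k → n ℕ.≤ suc k ℕ.+ k → n C suc k ℕ.≤ n C k
  C-descending n k le = ℕ.*-cancelˡ-≤ (suc k) (ℕ.+-cancelʳ-≤ (k ℕ.* (n C k)) _ _ (begin
    suc k ℕ.* (n C suc k) ℕ.+ k ℕ.* (n C k) ≡⟨ absorption n k ⟩
    n ℕ.* (n C k)                           ≤⟨ ℕ.*-monoˡ-≤ (n C k) le ⟩
    (suc k ℕ.+ k) ℕ.* (n C k)               ≡⟨ ℕ.*-distribʳ-+ (n C k) (suc k) k ⟩
    suc k ℕ.* (n C k) ℕ.+ k ℕ.* (n C k)     ∎))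
    where open ℕ.≤-Reasoning

  d*2≡d+d : ∀ d → d ℕ.* 2 ≡ d ℕ.+ d
  d*2≡d+d = ℕ-Solver.solve-∀

  central-max : ∀ d j → (d ℕ.* 2) C j ℕ.≤ (d ℕ.* 2) C d
  central-max d j with ℕ.≤-total j d
  ... | inj₁ j≤d = up (ℕ.≤⇒≤′ j≤d) ℕ.≤-refl
    where
    up : ∀ {e} → j ℕ.≤′ e → e ℕ.≤ d → (d ℕ.* 2) C j ℕ.≤ (d ℕ.* 2) C e
    up ℕ.≤′-refl e≤d = ℕ.≤-refl
    up {suc e} (ℕ.≤′-step j≤e) e<d = ℕ.≤-trans (up j≤e (ℕ.<⇒≤ e<d))
      (C-ascending (d ℕ.* 2) e (subst (suc e ℕ.+ e ℕ.≤_) (sym (d*2≡d+d d)) (ℕ.+-mono-≤ e<d (ℕ.<⇒≤ e<d))))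
  ... | inj₂ d≤j = down (ℕ.≤⇒≤′ d≤j)
    where
    down : ∀ {e} → d ℕ.≤′ e → (d ℕ.* 2) C e ℕ.≤ (d ℕ.* 2) C d
    down ℕ.≤′-refl = ℕ.≤-refl
    down {suc e} (ℕ.≤′-step d≤e) = ℕ.≤-trans
      (C-descending (d ℕ.* 2) e (subst (ℕ._≤ suc e ℕ.+ e) (sym (d*2≡d+d d))
        (ℕ.+-mono-≤ (ℕ.m≤n⇒m≤1+n (ℕ.≤′⇒≤ d≤e)) (ℕ.≤′⇒≤ d≤e))))
      (down d≤e)

  -- Estimates for alternating sums

  sumTo : ℕ → (ℕ → ℕ) → ℕ
  sumTo zero    a = 0
  sumTo (suc k) a = a 0 ℕ.+ sumTo k (a ∘ suc)

  sumTo-mono-* : ∀ c k {a b} → (∀ j → a j ℕ.≤ c ℕ.* b j) → sumTo k a ℕ.≤ c ℕ.* sumTo k b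
  sumTo-mono-* c zero    le = z≤n
  sumTo-mono-* c (suc k) {a} {b} le = ℕ.≤-trans (ℕ.+-mono-≤ (le 0) (sumTo-mono-* c k (le ∘ suc)))
    (ℕ.≤-reflexive (sym (ℕ.*-distribˡ-+ c (b 0) _)))

  sumTo-snoc : ∀ k a → sumTo (suc k) a ≡ a k ℕ.+ sumTo k a
  sumTo-snoc zero    a = refl
  sumTo-snoc (suc k) a = trans (cong (a 0 ℕ.+_) (sumTo-snoc k (a ∘ suc))) (swap (a 0) (a (suc k)) _)
    where
    swap : ∀ x y z → x ℕ.+ (y ℕ.+ z) ≡ y ℕ.+ (x ℕ.+ z)
    swap = ℕ-Solver.solve-∀

  ∣i-j∣≤∣i∣+∣j∣ : ∀ i j → ℤ.∣ i - j ∣ ℕ.≤ ℤ.∣ i ∣ ℕ.+ ℤ.∣ j ∣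
  ∣i-j∣≤∣i∣+∣j∣ i j = ℕ.≤-trans (ℤ.∣i+j∣≤∣i∣+∣j∣ i (- j)) (ℕ.≤-reflexive (cong (ℤ.∣ i ∣ ℕ.+_) (ℤ.∣-i∣≡∣i∣ j)))

  altSum-bound : ∀ k h → ℤ.∣ altSum k h ∣ ℕ.≤ sumTo k (ℤ.∣_∣ ∘ h)
  altSum-bound zero    h = z≤n
  altSum-bound (suc k) h = ℕ.≤-trans (∣i-j∣≤∣i∣+∣j∣ (h 0) _) (ℕ.+-monoʳ-≤ ℤ.∣ h 0 ∣ (altSum-bound k (h ∘ suc)))

  -- Triangle inequality around the term of index a. The tails stay separate because they later run
  -- through the squares in opposite orders.
  altSum-pivot : ∀ a b h → ℤ.∣ h a ∣ ℕ.≤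
    ℤ.∣ altSum (a ℕ.+ suc b) h ∣ ℕ.+ sumTo a (ℤ.∣_∣ ∘ h) ℕ.+ sumTo b (λ j → ℤ.∣ h (suc a ℕ.+ j) ∣)
  altSum-pivot zero b h = begin
    ℤ.∣ h 0 ∣                       ≡⟨ cong ℤ.∣_∣ (cancel (h 0) s) ⟩
    ℤ.∣ (h 0 - s) + s ∣             ≤⟨ ℤ.∣i+j∣≤∣i∣+∣j∣ (h 0 - s) s ⟩
    ℤ.∣ h 0 - s ∣ ℕ.+ ℤ.∣ s ∣       ≤⟨ ℕ.+-mono-≤ (ℕ.m≤m+n _ 0) (altSum-bound b (h ∘ suc)) ⟩
    ℤ.∣ h 0 - s ∣ ℕ.+ 0 ℕ.+ sumTo b (λ j → ℤ.∣ h (suc j) ∣) ∎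
    where
    open ℕ.≤-Reasoning
    s = altSum b (h ∘ suc)
    cancel : ∀ x s → x ≡ (x + - s) + s
    cancel = solve-∀
  altSum-pivot (suc a) b h = begin
    ℤ.∣ h (suc a) ∣                       ≤⟨ altSum-pivot a b (h ∘ suc) ⟩
    ℤ.∣ s ∣ ℕ.+ A ℕ.+ B                   ≡⟨ cong (λ x → ℤ.∣ x ∣ ℕ.+ A ℕ.+ B) (cancel (h 0) s) ⟩
    ℤ.∣ h 0 - (h 0 - s) ∣ ℕ.+ A ℕ.+ B     ≤⟨ ℕ.+-monoˡ-≤ B (ℕ.+-monoˡ-≤ A (∣i-j∣≤∣i∣+∣j∣ (h 0) (h 0 - s))) ⟩
    ℤ.∣ h 0 ∣ ℕ.+ ℤ.∣ h 0 - s ∣ ℕ.+ A ℕ.+ B ≡⟨ swap ℤ.∣ h 0 ∣ ℤ.∣ h 0 - s ∣ A B ⟩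
    ℤ.∣ h 0 - s ∣ ℕ.+ (ℤ.∣ h 0 ∣ ℕ.+ A) ℕ.+ B ∎
    where
    open ℕ.≤-Reasoning
    s = altSum (a ℕ.+ suc b) (h ∘ suc)
    A = sumTo a (ℤ.∣_∣ ∘ h ∘ suc)
    B = sumTo b (λ j → ℤ.∣ h (suc (suc a) ℕ.+ j) ∣)
    cancel : ∀ x s → s ≡ x + - (x + - s)
    cancel = solve-∀
    swap : ∀ p q r s → p ℕ.+ q ℕ.+ r ℕ.+ s ≡ q ℕ.+ (p ℕ.+ r) ℕ.+ s
    swap = ℕ-Solver.solve-∀

  -- The 2d-th central difference of g vanishes and its largest weight is the
  -- one at the centre d.
  central-bound : ∀ d g → Poly (d ℕ.* 2) g → ℤ.∣ g d ∣ ℕ.≤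
    sumTo d (ℤ.∣_∣ ∘ g) ℕ.+ sumTo d (λ j → ℤ.∣ g (suc d ℕ.+ j) ∣)
  central-bound d g p = ℕ.*-cancelˡ-≤ c {{ℕ.>-nonZero (central-max d 0)}} (begin
    c ℕ.* ℤ.∣ g d ∣                      ≡⟨ ℤ.abs-* (+ c) (g d) ⟨
    ℤ.∣ h d ∣                            ≤⟨ altSum-pivot d d h ⟩
    ℤ.∣ altSum (d ℕ.+ suc d) h ∣ ℕ.+ sumTo d (ℤ.∣_∣ ∘ h) ℕ.+ sumTo d (λ j → ℤ.∣ h (suc d ℕ.+ j) ∣)
      ≡⟨ cong (λ s → ℤ.∣ s ∣ ℕ.+ sumTo d (ℤ.∣_∣ ∘ h) ℕ.+ sumTo d (λ j → ℤ.∣ h (suc d ℕ.+ j) ∣))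
           (binomial-altSum (d ℕ.* 2) g 2d< p) ⟩
    sumTo d (ℤ.∣_∣ ∘ h) ℕ.+ sumTo d (λ j → ℤ.∣ h (suc d ℕ.+ j) ∣)
      ≤⟨ ℕ.+-mono-≤ (sumTo-mono-* c d weight) (sumTo-mono-* c d (λ j → weight (suc d ℕ.+ j))) ⟩
    c ℕ.* sumTo d (ℤ.∣_∣ ∘ g) ℕ.+ c ℕ.* sumTo d (λ j → ℤ.∣ g (suc d ℕ.+ j) ∣)
      ≡⟨ ℕ.*-distribˡ-+ c (sumTo d (ℤ.∣_∣ ∘ g)) _ ⟨
    c ℕ.* (sumTo d (ℤ.∣_∣ ∘ g) ℕ.+ sumTo d (λ j → ℤ.∣ g (suc d ℕ.+ j) ∣)) ∎)
    where
    open ℕ.≤-Reasoning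
    c = (d ℕ.* 2) C d
    h : ℕ → ℤ
    h j = + ((d ℕ.* 2) C j) * g j
    2d< : d ℕ.* 2 ℕ.< d ℕ.+ suc d
    2d< = ℕ.≤-reflexive (trans (cong suc (d*2≡d+d d)) (sym (ℕ.+-suc d d)))
    weight : ∀ j → ℤ.∣ h j ∣ ℕ.≤ c ℕ.* ℤ.∣ g j ∣
    weight j = ℕ.≤-trans (ℕ.≤-reflexive (ℤ.abs-* (+ ((d ℕ.* 2) C j)) (g j))) (ℕ.*-monoˡ-≤ ℤ.∣ g j ∣ (central-max d j))

  -- The identity d/(d+1) + 1/((d+1)(d+2)) = (d+1)/(d+2) with denominators cleared: the inductive
  -- step for summing 1/(i(i+1)).
  telescope-step : ∀ d K s a → suc d ℕ.* s ℕ.≤ d ℕ.* K → suc d ℕ.* suc (suc d) ℕ.* a ℕ.≤ K →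
                   suc (suc d) ℕ.* (a ℕ.+ s) ℕ.≤ suc d ℕ.* K
  telescope-step d K s a hs ha = ℕ.*-cancelˡ-≤ (suc d) (begin
    suc d ℕ.* (suc (suc d) ℕ.* (a ℕ.+ s))                            ≡⟨ split d a s ⟩
    suc d ℕ.* suc (suc d) ℕ.* a ℕ.+ suc (suc d) ℕ.* (suc d ℕ.* s)    ≤⟨ ℕ.+-mono-≤ ha (ℕ.*-monoʳ-≤ (suc (suc d)) hs) ⟩
    K ℕ.+ suc (suc d) ℕ.* (d ℕ.* K)                                  ≡⟨ join d K ⟩
    suc d ℕ.* (suc d ℕ.* K)                                          ∎)
    where
    open ℕ.≤-Reasoning
    split : ∀ d a s → suc d ℕ.* (suc (suc d) ℕ.* (a ℕ.+ s)) ≡ suc d ℕ.* suc (suc d) ℕ.* a ℕ.+ suc (suc d) ℕ.* (suc d ℕ.* s)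
    split = ℕ-Solver.solve-∀
    join : ∀ d K → K ℕ.+ suc (suc d) ℕ.* (d ℕ.* K) ≡ suc d ℕ.* (suc d ℕ.* K)
    join = ℕ-Solver.solve-∀

  telescope↑ : ∀ d K a → (∀ i → i ℕ.< d → suc i ℕ.* suc (suc i) ℕ.* a i ℕ.≤ K) → suc d ℕ.* sumTo d a ℕ.≤ d ℕ.* K
  telescope↑ zero    K a le = z≤n
  telescope↑ (suc d) K a le rewrite sumTo-snoc d a =
    telescope-step d K (sumTo d a) (a d) (telescope↑ d K a (λ i i<d → le i (ℕ.m<n⇒m<1+n i<d))) (le d ℕ.≤-refl)

  telescope↓ : ∀ d K a → (∀ j i → j ℕ.+ suc i ≡ d → suc i ℕ.* suc (suc i) ℕ.* a j ℕ.≤ K) → suc d ℕ.* sumTo d a ℕ.≤ d ℕ.* K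
  telescope↓ zero    K a le = z≤n
  telescope↓ (suc d) K a le =
    telescope-step d K (sumTo d (a ∘ suc)) (a 0) (telescope↓ d K (a ∘ suc) (λ j i eq → le (suc j) i (cong suc eq))) (le 0 d refl)

  telescoped : ∀ d K s → suc d ℕ.* s ℕ.≤ d ℕ.* K → s ℕ.≤ K
  telescoped d K s le = ℕ.*-cancelˡ-≤ (suc d) (ℕ.≤-trans le (ℕ.*-monoˡ-≤ K (ℕ.n≤1+n d)))

  -- Markov's inequality for disjoint sensitive blocks

  Signed : BoolFn t → Set
  Signed f = ∀ z → (f z ≡ + 1) ⊎ (f z ≡ -[1+ 0 ])

  flip-diff : Subset t → BoolFn t → BoolFn t
  flip-diff B f z = f (B ⊕ z) + -1ℤ * f z

  -- N^|Bs| times the expectation of f when each block of Bs is flipped in ⊥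
  -- independently with probability u/N.
  noise : ℤ → ℤ → List (Subset t) → BoolFn t → ℤ
  noise N u []       f = f ⊥
  noise N u (B ∷ Bs) f = (N - u) * noise N u Bs f + u * noise N u Bs (f ∘ (B ⊕_))

  -- The divided difference at 0 of u ↦ noise N u Bs f.
  slope : ℤ → ℤ → List (Subset t) → BoolFn t → ℤ
  slope N u []       f = 0ℤ
  slope N u (B ∷ Bs) f = N * slope N u Bs f + noise N u Bs (flip-diff B f)

  noise-linear : ∀ N u Bs a (f g : BoolFn t) →
                 noise N u Bs (λ z → f z + a * g z) ≡ noise N u Bs f + a * noise N u Bs g
  noise-linear N u []       a f g = refl
  noise-linear N u (B ∷ Bs) a f g
    rewrite noise-linear N u Bs a f g | noise-linear N u Bs a (f ∘ (B ⊕_)) (g ∘ (B ⊕_)) =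
    rearrange (N - u) u (noise N u Bs f) (noise N u Bs g) (noise N u Bs (f ∘ (B ⊕_))) (noise N u Bs (g ∘ (B ⊕_))) a
    where
    rearrange : ∀ v u p q r s a → v * (p + a * q) + u * (r + a * s) ≡ (v * p + u * r) + a * (v * q + u * s)
    rearrange = solve-∀

  noise-zero : ∀ N u Bs {f : BoolFn t} → (∀ z → f z ≡ 0ℤ) → noise N u Bs f ≡ 0ℤ
  noise-zero N u []       h = h ⊥
  noise-zero N u (B ∷ Bs) h
    rewrite noise-zero N u Bs h | noise-zero N u Bs (h ∘ (B ⊕_)) = zeros (N - u) u
    where
    zeros : ∀ a b → a * 0ℤ + b * 0ℤ ≡ 0ℤ
    zeros = solve-∀

  -- In this form each factor u is accompanied by a difference along a block, and such a difference
  -- lowers the block degree. This is what bounds the degree of `noise` in u.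
  noise-∷ : ∀ N u B Bs (f : BoolFn t) →
            noise N u (B ∷ Bs) f ≡ N * noise N u Bs f + u * noise N u Bs (flip-diff B f)
  noise-∷ N u B Bs f rewrite noise-linear N u Bs -1ℤ (f ∘ (B ⊕_)) f =
    rearrange N u (noise N u Bs f) (noise N u Bs (f ∘ (B ⊕_)))
    where
    rearrange : ∀ N u p q → (N + - u) * p + u * q ≡ N * p + u * (q + -1ℤ * p)
    rearrange = solve-∀

  noise-slope : ∀ N u Bs (f : BoolFn t) →
                noise N u Bs f ≡ N ℤ.^ length Bs * f ⊥ + u * slope N u Bs f
  noise-slope N u []       f = base u (f ⊥)
    where
    base : ∀ u x → x ≡ 1ℤ * x + u * 0ℤ
    base = solve-∀
  noise-slope N u (B ∷ Bs) f = trans (noise-∷ N u B Bs f) (trans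
    (cong (λ p → N * p + u * noise N u Bs (flip-diff B f)) (noise-slope N u Bs f))
    (rearrange N u (N ℤ.^ length Bs) (f ⊥) (slope N u Bs f) (noise N u Bs (flip-diff B f))))
    where
    rearrange : ∀ N u P x q r → N * (P * x + u * q) + u * r ≡ N * P * x + u * (N * q + r)
    rearrange = solve-∀

  noise-at-0 : ∀ N Bs (f : BoolFn t) → noise N 0ℤ Bs f ≡ N ℤ.^ length Bs * f ⊥
  noise-at-0 N Bs f = trans (noise-slope N 0ℤ Bs f) (drop (N ℤ.^ length Bs * f ⊥) (slope N 0ℤ Bs f))
    where
    drop : ∀ x y → x + 0ℤ * y ≡ x
    drop = solve-∀

  ⊕-⊥ : (B : Subset t) → B ⊕ ⊥ ≡ B
  ⊕-⊥ B = V.zipWith-identityʳ xor-identityʳ B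

  -- The derivative at 0 adds up the differences along single blocks, and a sensitive block
  -- contributes -2 f(0). The factor N on the left avoids the exponent `length Bs` - 1.
  slope-at-0 : ∀ N Bs (f : BoolFn t) → All (λ B → f B ≡ - f ⊥) Bs →
               N * slope N 0ℤ Bs f ≡ N ℤ.^ length Bs * (+ length Bs * (-[1+ 1 ] * f ⊥))
  slope-at-0 N []       f [] = base N (f ⊥)
    where
    base : ∀ N x → N * 0ℤ ≡ 1ℤ * (0ℤ * (-[1+ 1 ] * x))
    base = solve-∀
  slope-at-0 N (B ∷ Bs) f (eq ∷ eqs)
    rewrite noise-at-0 N Bs (flip-diff B f) | ⊕-⊥ B | eq = trans
      (cong (λ s → N * (s + N ℤ.^ length Bs * (- f ⊥ + -1ℤ * f ⊥))) (slope-at-0 N Bs f eqs))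
      (rearrange N (N ℤ.^ length Bs) (f ⊥) (+ length Bs))
    where
    rearrange : ∀ N P x b → N * (P * (b * (-[1+ 1 ] * x)) + P * (- x + -1ℤ * x)) ≡
                N * P * ((1ℤ + b) * (-[1+ 1 ] * x))
    rearrange = solve-∀

  -- With denominator u + v both weights u and v are natural numbers, so each step is a scaled
  -- convex combination.
  noise-bound : ∀ u v Bs (f : BoolFn t) → (∀ z → ℤ.∣ f z ∣ ℕ.≤ 1) →
                ℤ.∣ noise (+ (u ℕ.+ v)) (+ u) Bs f ∣ ℕ.≤ (u ℕ.+ v) ℕ.^ length Bs
  noise-bound u v []       f le = le ⊥
  noise-bound u v (B ∷ Bs) f le = begin
    ℤ.∣ (N - + u) * p + + u * q ∣                ≡⟨ cong (λ w → ℤ.∣ w * p + + u * q ∣) (cancel (+ u) (+ v)) ⟩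
    ℤ.∣ + v * p + + u * q ∣                      ≤⟨ ℤ.∣i+j∣≤∣i∣+∣j∣ (+ v * p) (+ u * q) ⟩
    ℤ.∣ + v * p ∣ ℕ.+ ℤ.∣ + u * q ∣              ≡⟨ cong₂ ℕ._+_ (ℤ.abs-* (+ v) p) (ℤ.abs-* (+ u) q) ⟩
    v ℕ.* ℤ.∣ p ∣ ℕ.+ u ℕ.* ℤ.∣ q ∣
      ≤⟨ ℕ.+-mono-≤ (ℕ.*-monoʳ-≤ v (noise-bound u v Bs f le)) (ℕ.*-monoʳ-≤ u (noise-bound u v Bs (f ∘ (B ⊕_)) (le ∘ (B ⊕_)))) ⟩
    v ℕ.* P ℕ.+ u ℕ.* P                          ≡⟨ ℕ.*-distribʳ-+ P v u ⟨
    (v ℕ.+ u) ℕ.* P                              ≡⟨ cong (ℕ._* P) (ℕ.+-comm v u) ⟩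
    (u ℕ.+ v) ℕ.* P                              ∎
    where
    open ℕ.≤-Reasoning
    N = + (u ℕ.+ v)
    P = (u ℕ.+ v) ℕ.^ length Bs
    p = noise N (+ u) Bs f
    q = noise N (+ u) Bs (f ∘ (B ⊕_))
    cancel : ∀ u v → u + v + - u ≡ v
    cancel = solve-∀

  -- The degree of a function along a family of blocks

  oddCount : List (Subset t) → Subset t → ℕ
  oddCount []       S = 0
  oddCount (B ∷ Bs) S = (if parity S B then 1 else 0) ℕ.+ oddCount Bs S

  -- Flipping B changes the sign of the character of S exactly when S meets B in an odd number of
  -- points. Hence `oddCount Bs S` is the degree in u of the noise average of that character.
  BlockDegree< : ℕ → List (Subset t) → BoolFn t → Set
  BlockDegree< n Bs f = ∀ S → n ℕ.≤ oddCount Bs S → coeff f S ≡ 0ℤ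

  BlockDegree-tail : ∀ n B Bs (f : BoolFn t) → BlockDegree< n (B ∷ Bs) f → BlockDegree< n Bs f
  BlockDegree-tail n B Bs f h S le = h S (ℕ.≤-trans le (ℕ.m≤n+m _ _))

  -- The difference along B multiplies the coefficient at S by the character value at B minus 1.
  -- This kills S when it meets B evenly; otherwise B accounts for one of the n + 1 odd
  -- intersections.
  BlockDegree-diff : ∀ n B Bs (f : BoolFn t) → BlockDegree< (suc n) (B ∷ Bs) f → BlockDegree< n Bs (flip-diff B f)
  BlockDegree-diff n B Bs f h S le
    rewrite coeff-linear -1ℤ (f ∘ (B ⊕_)) f S | coeff-shift f B S = by-parity (parity S B) (h S)
    where
    cancel : ∀ c → 1ℤ * c + -1ℤ * c ≡ 0ℤ
    cancel = solve-∀
    by-parity : ∀ b → (suc n ℕ.≤ (if b then 1 else 0) ℕ.+ oddCount Bs S → coeff f S ≡ 0ℤ) →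
                sgn b * coeff f S + -1ℤ * coeff f S ≡ 0ℤ
    by-parity true  vanish rewrite vanish (s≤s le) = refl
    by-parity false vanish = cancel (coeff f S)

  module _ (N c : ℤ) where

    square : ℕ → ℤ
    square j = (+ j - c) * (+ j - c)

    Poly-square : ∀ n g → Poly n g → Poly (2 ℕ.+ n) (λ j → square j * g j)
    Poly-square n g p = Poly-cong (2 ℕ.+ n) (λ j → sym (ℤ.*-assoc (+ j - c) (+ j - c) (g j)))
      (Poly-linear (suc n) c (λ j → (+ j - c) * g j) (Poly-linear n c g p))

    -- Every difference along a block costs one unit of block degree and brings one factor u = (j -
    -- c)², that is, two degrees in j.
    noise-Poly : ∀ n Bs (f : BoolFn t) → BlockDegree< n Bs f → Poly (n ℕ.* 2) (λ j → noise N (square j) Bs f)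
    noise-Poly zero    Bs       f h j = noise-zero N (square j) Bs (coeff≡0⇒≡0 f (λ S → h S z≤n))
    noise-Poly (suc n) []       f h   = Poly-const (suc (n ℕ.* 2)) (f ⊥)
    noise-Poly (suc n) (B ∷ Bs) f h   =
      Poly-cong (suc n ℕ.* 2) (λ j → sym (noise-∷ N (square j) B Bs f))
        (Poly-+ (suc n ℕ.* 2) (λ j → N * noise N (square j) Bs f) (λ j → square j * noise N (square j) Bs (flip-diff B f))
          (Poly-* (suc n ℕ.* 2) N (λ j → noise N (square j) Bs f) (noise-Poly (suc n) Bs f (BlockDegree-tail (suc n) B Bs f h)))
          (Poly-square (n ℕ.* 2) (λ j → noise N (square j) Bs (flip-diff B f)) (noise-Poly n Bs (flip-diff B f) (BlockDegree-diff n B Bs f h))))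

    -- Dividing by u saves one unit: block degree at most n leaves degree below 2n in j.
    slope-Poly : ∀ n Bs (f : BoolFn t) → BlockDegree< (suc n) Bs f → Poly (n ℕ.* 2) (λ j → slope N (square j) Bs f)
    slope-Poly zero    []       f h   = λ _ → refl
    slope-Poly (suc n) []       f h   = Poly-const (suc (n ℕ.* 2)) 0ℤ
    slope-Poly n       (B ∷ Bs) f h   =
      Poly-+ (n ℕ.* 2) (λ j → N * slope N (square j) Bs f) (λ j → noise N (square j) Bs (flip-diff B f))
        (Poly-* (n ℕ.* 2) N (λ j → slope N (square j) Bs f) (slope-Poly n Bs f (BlockDegree-tail (suc n) B Bs f h)))
        (noise-Poly n Bs (flip-diff B f) (BlockDegree-diff n B Bs f h))

  ∣Signed∣ : {f : BoolFn t} → Signed f → ∀ z → ℤ.∣ f z ∣ ≡ 1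
  ∣Signed∣ sf z with sf z
  ... | inj₁ eq = cong ℤ.∣_∣ eq
  ... | inj₂ eq = cong ℤ.∣_∣ eq

  -- u times the slope is the difference of two noise values, at u and at 0, each bounded by N^b for
  -- b blocks and N = u + v.
  slope-bound : ∀ u v Bs {f : BoolFn t} → Signed f →
                u ℕ.* ℤ.∣ slope (+ (u ℕ.+ v)) (+ u) Bs f ∣ ℕ.≤ 2 ℕ.* (u ℕ.+ v) ℕ.^ length Bs
  slope-bound u v Bs {f} sf = begin
    u ℕ.* ℤ.∣ s ∣              ≡⟨ ℤ.abs-* (+ u) s ⟨
    ℤ.∣ + u * s ∣              ≡⟨ cong ℤ.∣_∣ (trans (isolate (N ℤ.^ length Bs * f ⊥) (+ u * s))
                                    (cong (_- (N ℤ.^ length Bs * f ⊥)) (sym (noise-slope N (+ u) Bs f)))) ⟩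
    ℤ.∣ noise N (+ u) Bs f - N ℤ.^ length Bs * f ⊥ ∣
      ≤⟨ ∣i-j∣≤∣i∣+∣j∣ (noise N (+ u) Bs f) (N ℤ.^ length Bs * f ⊥) ⟩
    ℤ.∣ noise N (+ u) Bs f ∣ ℕ.+ ℤ.∣ N ℤ.^ length Bs * f ⊥ ∣
      ≡⟨ cong (λ w → ℤ.∣ noise N (+ u) Bs f ∣ ℕ.+ ℤ.∣ w ∣) (noise-at-0 N Bs f) ⟨
    ℤ.∣ noise N (+ u) Bs f ∣ ℕ.+ ℤ.∣ noise N 0ℤ Bs f ∣
      ≤⟨ ℕ.+-mono-≤ (noise-bound u v Bs f le) (noise-bound 0 (u ℕ.+ v) Bs f le) ⟩
    P ℕ.+ P                    ≡⟨ cong (P ℕ.+_) (ℕ.+-identityʳ P) ⟨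
    2 ℕ.* P                    ∎
    where
    open ℕ.≤-Reasoning
    N = + (u ℕ.+ v)
    P = (u ℕ.+ v) ℕ.^ length Bs
    s = slope N (+ u) Bs f
    le : ∀ z → ℤ.∣ f z ∣ ℕ.≤ 1
    le z = ℕ.≤-reflexive (∣Signed∣ sf z)
    isolate : ∀ x y → y ≡ (x + y) + - x
    isolate = solve-∀

  ∣+^∣ : ∀ n k → ℤ.∣ (+ n) ℤ.^ k ∣ ≡ n ℕ.^ k
  ∣+^∣ n zero    = refl
  ∣+^∣ n (suc k) = trans (ℤ.abs-* (+ n) ((+ n) ℤ.^ k)) (cong (n ℕ.*_) (∣+^∣ n k))

  -- Markov's inequality at the endpoint 0: the slope is controlled through its
  -- values at the points k², where the noise is bounded.
  blocks-bound : ∀ d Bs {f : BoolFn t} → 0 ℕ.< d → Signed f → All (λ B → f B ≡ - f ⊥) Bs →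
                 BlockDegree< (suc d) Bs f → length Bs ℕ.≤ 4 ℕ.* (d ℕ.* d)
  blocks-bound d@(suc _) Bs {f} 0<d sf sens deg =
    ℕ.*-cancelˡ-≤ (2 ℕ.* P) {{ℕ.m*n≢0 2 P {{_}} {{ℕ.m^n≢0 N (length Bs)}}}} (begin
      2 ℕ.* P ℕ.* b                                ≡⟨ value ⟨
      N ℕ.* ℤ.∣ slope (+ N) 0ℤ Bs f ∣              ≡⟨ cong (λ u → N ℕ.* ℤ.∣ slope (+ N) u Bs f ∣) centre ⟨
      N ℕ.* ℤ.∣ g d ∣                              ≤⟨ ℕ.*-monoʳ-≤ N (central-bound d g (slope-Poly (+ N) (+ d) d Bs f deg)) ⟩
      N ℕ.* (sumTo d (ℤ.∣_∣ ∘ g) ℕ.+ sumTo d (λ j → ℤ.∣ g (suc d ℕ.+ j) ∣))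
        ≤⟨ ℕ.*-monoʳ-≤ N (ℕ.+-mono-≤ (telescoped d (4 ℕ.* P) (sumTo d (ℤ.∣_∣ ∘ g)) (telescope↓ d (4 ℕ.* P) (ℤ.∣_∣ ∘ g) left))
                                      (telescoped d (4 ℕ.* P) (sumTo d (λ j → ℤ.∣ g (suc d ℕ.+ j) ∣)) (telescope↑ d (4 ℕ.* P) (λ j → ℤ.∣ g (suc d ℕ.+ j) ∣) right))) ⟩
      N ℕ.* (4 ℕ.* P ℕ.+ 4 ℕ.* P)                  ≡⟨ regroup N P ⟩
      2 ℕ.* P ℕ.* (4 ℕ.* N)                        ∎)
    where
    open ℕ.≤-Reasoning
    -- For 0 ≤ j ≤ 2d the largest sample (j - d)² is d², so with this denominator all flip
    -- probabilities are at most 1.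
    N = d ℕ.* d
    b = length Bs
    P = N ℕ.^ b
    g : ℕ → ℤ
    g j = slope (+ N) (square (+ N) (+ d) j) Bs f
    centre : square (+ N) (+ d) d ≡ 0ℤ
    centre = cong (λ x → x * x) (ℤ.+-inverseʳ (+ d))
    value : N ℕ.* ℤ.∣ slope (+ N) 0ℤ Bs f ∣ ≡ 2 ℕ.* P ℕ.* b
    value = begin-equality
      N ℕ.* ℤ.∣ slope (+ N) 0ℤ Bs f ∣  ≡⟨ ℤ.abs-* (+ N) (slope (+ N) 0ℤ Bs f) ⟨
      ℤ.∣ + N * slope (+ N) 0ℤ Bs f ∣  ≡⟨ cong ℤ.∣_∣ (slope-at-0 (+ N) Bs f sens) ⟩
      ℤ.∣ (+ N) ℤ.^ b * (+ b * (-[1+ 1 ] * f ⊥)) ∣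
        ≡⟨ trans (ℤ.abs-* ((+ N) ℤ.^ b) _) (cong₂ ℕ._*_ (∣+^∣ N b)
             (trans (ℤ.abs-* (+ b) (-[1+ 1 ] * f ⊥)) (cong (b ℕ.*_)
             (trans (ℤ.abs-* -[1+ 1 ] (f ⊥)) (cong (2 ℕ.*_) (∣Signed∣ sf ⊥)))))) ⟩
      P ℕ.* (b ℕ.* 2)                  ≡⟨ swap P b ⟩
      2 ℕ.* P ℕ.* b                    ∎
      where
      swap : ∀ P b → P ℕ.* (b ℕ.* 2) ≡ 2 ℕ.* P ℕ.* b
      swap = ℕ-Solver.solve-∀
    regroup : ∀ N P → N ℕ.* (4 ℕ.* P ℕ.+ 4 ℕ.* P) ≡ 2 ℕ.* P ℕ.* (4 ℕ.* N)
    regroup = ℕ-Solver.solve-∀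
    at-square : ∀ i {x} → suc i ℕ.≤ d → x ≡ + (suc i ℕ.* suc i) →
                suc i ℕ.* suc (suc i) ℕ.* ℤ.∣ slope (+ N) x Bs f ∣ ℕ.≤ 4 ℕ.* P
    at-square i {x} i<d refl with ℕ.m≤n⇒∃[o]m+o≡n (ℕ.*-mono-≤ i<d i<d)
    ... | v , eq = begin
      -- With i + 1 as the index, (i+1)(i+2) ≤ 2(i+1)² replaces 1/(i+1)² by 2/((i+1)(i+2)), a sum
      -- that telescopes.
      suc i ℕ.* suc (suc i) ℕ.* q          ≤⟨ ℕ.m≤m+n _ (suc i ℕ.* i ℕ.* q) ⟩
      suc i ℕ.* suc (suc i) ℕ.* q ℕ.+ suc i ℕ.* i ℕ.* q ≡⟨ double i q ⟩
      2 ℕ.* (u ℕ.* q)                      ≡⟨ cong (λ M → 2 ℕ.* (u ℕ.* ℤ.∣ slope (+ M) (+ u) Bs f ∣)) eq ⟨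
      2 ℕ.* (u ℕ.* ℤ.∣ slope (+ (u ℕ.+ v)) (+ u) Bs f ∣) ≤⟨ ℕ.*-monoʳ-≤ 2 (slope-bound u v Bs sf) ⟩
      2 ℕ.* (2 ℕ.* (u ℕ.+ v) ℕ.^ b)        ≡⟨ cong (λ M → 2 ℕ.* (2 ℕ.* M ℕ.^ b)) eq ⟩
      2 ℕ.* (2 ℕ.* P)                      ≡⟨ ℕ.*-assoc 2 2 P ⟨
      4 ℕ.* P                              ∎
      where
      u = suc i ℕ.* suc i
      q = ℤ.∣ slope (+ N) (+ u) Bs f ∣
      double : ∀ i q → suc i ℕ.* suc (suc i) ℕ.* q ℕ.+ suc i ℕ.* i ℕ.* q ≡ 2 ℕ.* (suc i ℕ.* suc i ℕ.* q)
      double = ℕ-Solver.solve-∀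
    left : ∀ j i → j ℕ.+ suc i ≡ d → suc i ℕ.* suc (suc i) ℕ.* ℤ.∣ g j ∣ ℕ.≤ 4 ℕ.* P
    left j i eq = at-square i (subst (suc i ℕ.≤_) eq (ℕ.m≤n+m (suc i) j))
      (trans (cong (λ e → (+ j - + e) * (+ j - + e)) (sym eq)) (trans (cancel (+ j) (+ suc i)) (sym (ℤ.pos-* (suc i) (suc i)))))
      where
      cancel : ∀ j i → (j + - (j + i)) * (j + - (j + i)) ≡ i * i
      cancel = solve-∀
    right : ∀ i → i ℕ.< d → suc i ℕ.* suc (suc i) ℕ.* ℤ.∣ g (suc d ℕ.+ i) ∣ ℕ.≤ 4 ℕ.* P
    right i i<d = at-square i i<d (trans (cong (λ e → (+ e - + d) * (+ e - + d)) (sym (ℕ.+-suc d i)))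
      (trans (cancel (+ d) (+ suc i)) (sym (ℤ.pos-* (suc i) (suc i)))))
      where
      cancel : ∀ d i → (d + i + - d) * (d + i + - d) ≡ i * i
      cancel = solve-∀

  -- Decision trees

  Degree< : ℕ → BoolFn t → Set
  Degree< n f = ∀ S → n ℕ.≤ ∣ S ∣ → coeff f S ≡ 0ℤ

  coeff-inside : (f : BoolFn (suc t)) (S : Subset t) →
    coeff (λ z → f (false ∷ z) + -1ℤ * f (true ∷ z)) S ≡ coeff f (inside ∷ S)
  coeff-inside f = coeff-linear -1ℤ (f ∘ (false ∷_)) (f ∘ (true ∷_))

  degree<1⇒constant : {f : BoolFn t} → Degree< 1 f → ∀ z → f z ≡ f ⊥
  degree<1⇒constant h []      = refl
  degree<1⇒constant {f = f} h (b ∷ z) = trans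
    (degree<1⇒constant (λ S le → coeff-face f b S (h (outside ∷ S) le) (h (inside ∷ S) (s≤s z≤n))) z)
    (equal b)
    where
    isolate : ∀ x y → y ≡ x + - (x + -1ℤ * y)
    isolate = solve-∀
    equal : ∀ b → f (b ∷ ⊥) ≡ f (false ∷ ⊥)
    equal false = refl
    equal true  = trans (isolate (f (false ∷ ⊥)) (f (true ∷ ⊥))) (trans
      (cong (λ x → f (false ∷ ⊥) + - x)
        (coeff≡0⇒≡0 (λ z → f (false ∷ z) + -1ℤ * f (true ∷ z))
          (λ S → trans (coeff-inside f S) (h (inside ∷ S) (s≤s z≤n))) ⊥))
      (ℤ.+-identityʳ (f (false ∷ ⊥))))

  coeff-const : ∀ a (S : Subset t) → 0 ℕ.< ∣ S ∣ → coeff (λ _ → a) S ≡ 0ℤ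
  coeff-const a (outside ∷ S) lt rewrite coeff-const a S lt = refl
  coeff-const a (inside ∷ S)  _  = cancel (coeff (λ _ → a) S)
    where
    cancel : ∀ c → c + -1ℤ * c ≡ 0ℤ
    cancel = solve-∀

  -- A top-degree coefficient is determined by the inputs supported in M. Along a coordinate outside
  -- M the two face coefficients agree, since their difference is a coefficient above the degree; so
  -- the coordinate can be set to 0.
  coeff-local : (f : BoolFn t) (M : Subset t) → Degree< (suc ∣ M ∣) f →
                (∀ A → f (A ∩ M) ≡ 0ℤ) → coeff f M ≡ 0ℤ
  coeff-local f []            deg vanish = vanish []
  coeff-local f (inside ∷ M)  deg vanish = trans (sym (coeff-inside f M))
    (coeff-local _ M (λ S le → trans (coeff-inside f S) (deg (inside ∷ S) (s≤s le)))
      (λ A → cong₂ (λ x y → x + -1ℤ * y) (vanish (false ∷ A)) (vanish (true ∷ A))))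
  coeff-local f (outside ∷ M) deg vanish = begin
    c₀ + 1ℤ * c₁            ≡⟨ rearrange c₀ c₁ ⟩
    (c₀ + c₀) - (c₀ + -1ℤ * c₁) ≡⟨ cong₂ (λ x y → (x + x) - y) c₀≡0 (deg (inside ∷ M) ℕ.≤-refl) ⟩
    0ℤ                      ∎
    where
    open ≡-Reasoning
    c₀ = coeff (f ∘ (false ∷_)) M
    c₁ = coeff (f ∘ (true ∷_)) M
    c₀≡0 : c₀ ≡ 0ℤ
    c₀≡0 = coeff-local (f ∘ (false ∷_)) M
      (λ S le → coeff-face f false S (deg (outside ∷ S) le) (deg (inside ∷ S) (ℕ.m≤n⇒m≤1+n le)))
      (λ A → vanish (false ∷ A))
    rearrange : ∀ x y → x + 1ℤ * y ≡ (x + x) + - (x + -1ℤ * y)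
    rearrange = solve-∀

  Leading : BoolFn t → ℕ → Subset t → Set
  Leading f d M = ∣ M ∣ ≡ d × coeff f M ≢ 0ℤ

  -- If no subset of M flipped the value, f - f(0) would vanish on all subsets of M and
  -- `coeff-local` would annihilate its coefficient there. As d > 0, subtracting a constant does not
  -- alter that coefficient.
  sensitive-inside : ∀ {d} (f : BoolFn t) → 0 ℕ.< d → Signed f → Degree< (suc d) f →
                     ∀ {M} → Leading f d M → ∃ λ A → f (A ∩ M) ≡ - f ⊥
  sensitive-inside f 0<d sf deg {M} (refl , cM≢0) with anySubset? (λ A → f (A ∩ M) ℤ.≟ - f ⊥)
  ... | yes found = found
  ... | no  none  = contradiction
    (trans (sym (shift M 0<d)) (coeff-local _ M (λ S le → trans (shift S (ℕ.≤-trans 0<d (ℕ.<⇒≤ le))) (deg S le))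
      (λ A → trans (cong (λ x → x + -1ℤ * f ⊥) (same A)) (cancel (f ⊥)))))
    cM≢0
    where
    cancel : ∀ x → x + -1ℤ * x ≡ 0ℤ
    cancel = solve-∀
    same : ∀ A → f (A ∩ M) ≡ f ⊥
    same A with sf (A ∩ M) | sf ⊥
    ... | inj₁ p | inj₁ q = trans p (sym q)
    ... | inj₂ p | inj₂ q = trans p (sym q)
    ... | inj₁ p | inj₂ q = contradiction (A , trans p (cong -_ (sym q))) none
    ... | inj₂ p | inj₁ q = contradiction (A , trans p (cong -_ (sym q))) none
    shift : ∀ S → 0 ℕ.< ∣ S ∣ → coeff (λ z → f z + -1ℤ * f ⊥) S ≡ coeff f S
    shift S lt = trans (coeff-linear -1ℤ f (λ _ → f ⊥) S)
      (trans (cong (λ x → coeff f S + -1ℤ * x) (coeff-const (f ⊥) S lt)) (ℤ.+-identityʳ (coeff f S)))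

  -- Disjoint families of leading sets

  ∣∩∣-∪ : (S A B : Subset t) → ∣ S ∩ A ∣ ℕ.+ ∣ S ∩ B ∣ ℕ.≤ ∣ S ∩ (A ∪ B) ∣ ℕ.+ ∣ A ∩ B ∣
  ∣∩∣-∪ []          []            []            = z≤n
  ∣∩∣-∪ (false ∷ S) (false ∷ A) (b ∷ B)     = ∣∩∣-∪ S A B
  ∣∩∣-∪ (false ∷ S) (true ∷ A)  (false ∷ B) = ∣∩∣-∪ S A B
  ∣∩∣-∪ (false ∷ S) (true ∷ A)  (true ∷ B)  = ℕ.≤-trans (∣∩∣-∪ S A B) (ℕ.+-monoʳ-≤ _ (ℕ.n≤1+n _))
  ∣∩∣-∪ (true ∷ S)  (false ∷ A) (false ∷ B) = ∣∩∣-∪ S A B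
  ∣∩∣-∪ (true ∷ S)  (false ∷ A) (true ∷ B)  rewrite ℕ.+-suc ∣ S ∩ A ∣ ∣ S ∩ B ∣ = s≤s (∣∩∣-∪ S A B)
  ∣∩∣-∪ (true ∷ S)  (true ∷ A)  (false ∷ B) = s≤s (∣∩∣-∪ S A B)
  ∣∩∣-∪ (true ∷ S)  (true ∷ A)  (true ∷ B)
    rewrite ℕ.+-suc ∣ S ∩ A ∣ ∣ S ∩ B ∣ | ℕ.+-suc ∣ S ∩ (A ∪ B) ∣ ∣ A ∩ B ∣ = s≤s (s≤s (∣∩∣-∪ S A B))

  ∣∪∣≤ : (A B : Subset t) → ∣ A ∪ B ∣ ℕ.≤ ∣ A ∣ ℕ.+ ∣ B ∣
  ∣∪∣≤ []          []          = z≤n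
  ∣∪∣≤ (false ∷ A) (false ∷ B) = ∣∪∣≤ A B
  ∣∪∣≤ (false ∷ A) (true ∷ B)  rewrite ℕ.+-suc ∣ A ∣ ∣ B ∣ = s≤s (∣∪∣≤ A B)
  ∣∪∣≤ (true ∷ A)  (false ∷ B) = s≤s (∣∪∣≤ A B)
  ∣∪∣≤ (true ∷ A)  (true ∷ B)  rewrite ℕ.+-suc ∣ A ∣ ∣ B ∣ = s≤s (ℕ.m≤n⇒m≤1+n (∣∪∣≤ A B))

  parity-∩ : (S A M : Subset t) → (if parity S (A ∩ M) then 1 else 0) ℕ.≤ ∣ S ∩ M ∣
  parity-∩ []          []          []          = z≤n
  parity-∩ (false ∷ S) (a ∷ A)     (m ∷ M)     = parity-∩ S A M
  parity-∩ (true ∷ S)  (false ∷ A) (false ∷ M) = parity-∩ S A M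
  parity-∩ (true ∷ S)  (true ∷ A)  (false ∷ M) = parity-∩ S A M
  parity-∩ (true ∷ S)  (a ∷ A)     (true ∷ M)  = ℕ.≤-trans (if≤1 _) (s≤s z≤n)
    where
    if≤1 : ∀ b → (if b then 1 else 0) ℕ.≤ 1
    if≤1 false = z≤n
    if≤1 true  = ℕ.≤-refl

  data Packing {t} : List (Subset t) → Set where
    []  : Packing []
    _∷_ : ∀ {M Ms} → ∣ M ∩ ⋃ Ms ∣ ≡ 0 → Packing Ms → Packing (M ∷ Ms)

  -- One sensitive block is chosen inside each leading set. By disjointness S meets at most |S| of
  -- them, so the degree of f also bounds its block degree.
  packing-blocks : ∀ {d} (f : BoolFn t) → 0 ℕ.< d → Signed f → Degree< (suc d) f →
    ∀ {Ms} → Packing Ms → All (Leading f d) Ms →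
    ∃ λ Bs → length Bs ≡ length Ms × All (λ B → f B ≡ - f ⊥) Bs × (∀ S → oddCount Bs S ℕ.≤ ∣ S ∩ ⋃ Ms ∣)
  packing-blocks f 0<d sf deg [] [] = [] , refl , [] , λ _ → z≤n
  packing-blocks f 0<d sf deg {M ∷ Ms} (disj ∷ pack) (lead ∷ leads)
    with sensitive-inside f 0<d sf deg {M} lead | packing-blocks f 0<d sf deg pack leads
  ... | A , flips | Bs , len , all , count = A ∩ M ∷ Bs , cong suc len , flips ∷ all , λ S → begin
    (if parity S (A ∩ M) then 1 else 0) ℕ.+ oddCount Bs S ≤⟨ ℕ.+-mono-≤ (parity-∩ S A M) (count S) ⟩
    ∣ S ∩ M ∣ ℕ.+ ∣ S ∩ ⋃ Ms ∣                            ≤⟨ ∣∩∣-∪ S M (⋃ Ms) ⟩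
    ∣ S ∩ (M ∪ ⋃ Ms) ∣ ℕ.+ ∣ M ∩ ⋃ Ms ∣                   ≡⟨ cong (∣ S ∩ (M ∪ ⋃ Ms) ∣ ℕ.+_) disj ⟩
    ∣ S ∩ (M ∪ ⋃ Ms) ∣ ℕ.+ 0                              ≡⟨ ℕ.+-identityʳ _ ⟩
    ∣ S ∩ (M ∪ ⋃ Ms) ∣                                    ∎
    where open ℕ.≤-Reasoning


  packing-size : ∀ {d} (f : BoolFn t) → 0 ℕ.< d → Signed f → Degree< (suc d) f →
    ∀ {Ms} → Packing Ms → All (Leading f d) Ms → length Ms ℕ.≤ 4 ℕ.* (d ℕ.* d)
  packing-size {d = d} f 0<d sf deg {Ms} pack leads with packing-blocks f 0<d sf deg pack leads
  ... | Bs , len , all , count = subst (ℕ._≤ 4 ℕ.* (d ℕ.* d)) len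
    (blocks-bound d Bs 0<d sf all λ S le →
      deg S (ℕ.≤-trans le (ℕ.≤-trans (count S) (∣p∩q∣≤∣p∣ S (⋃ Ms)))))

  LeadingCover : BoolFn t → ℕ → Set
  LeadingCover f d = ∃ λ Ms → All (Leading f d) Ms × length Ms ℕ.≤ 4 ℕ.* (d ℕ.* d) ×
                     (∀ S → ∣ S ∣ ≡ d → ∣ S ∩ ⋃ Ms ∣ ≡ 0 → coeff f S ≡ 0ℤ)

  maximal-packing : ∀ {d} (f : BoolFn t) → 0 ℕ.< d → Signed f → Degree< (suc d) f →
    LeadingCover f d
  -- Greedy extension; the fuel exceeds the bound of `packing-size` by one, so running out of it is
  -- contradictory.
  maximal-packing {t} {d} f 0<d sf deg = extend (suc (4 ℕ.* (d ℕ.* d))) [] [] refl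
    where
    extend : ∀ r {Ms} → Packing Ms → All (Leading f d) Ms → length Ms ℕ.+ r ≡ suc (4 ℕ.* (d ℕ.* d)) → LeadingCover f d
    extend zero {Ms} pack leads eq = contradiction
      (ℕ.≤-trans (ℕ.≤-reflexive (trans (sym eq) (ℕ.+-identityʳ _))) (packing-size f 0<d sf deg pack leads))
      (ℕ.<-irrefl refl)
    extend (suc r) {Ms} pack leads eq
      with anySubset? (λ S → (∣ S ∣ ℕ.≟ d) ×-dec ((∣ S ∩ ⋃ Ms ∣ ℕ.≟ 0) ×-dec (¬? (coeff f S ℤ.≟ 0ℤ))))
    ... | yes (S , size , disj , cS≢0) =
      extend r {S ∷ Ms} (disj ∷ pack) ((size , cS≢0) ∷ leads) (trans (sym (ℕ.+-suc (length Ms) r)) eq)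
    ... | no none = Ms , leads , packing-size f 0<d sf deg pack leads , λ S size disj →
      decidable-stable (coeff f S ℤ.≟ 0ℤ) λ cS≢0 → none (S , size , disj , cS≢0)

  -- Fixing the value of a variable

  coeff-fix-inside : ∀ (f : BoolFn t) i c S → lookup S i ≡ true → coeff (f ∘ (_[ i ]≔ c)) S ≡ 0ℤ
  coeff-fix-inside f zero    c (true ∷ S) refl = cancel (coeff (f ∘ (c ∷_)) S)
    where
    cancel : ∀ x → x + -1ℤ * x ≡ 0ℤ
    cancel = solve-∀
  coeff-fix-inside f (suc i) c (s ∷ S) eq
    rewrite coeff-fix-inside (f ∘ (false ∷_)) i c S eq | coeff-fix-inside (f ∘ (true ∷_)) i c S eq
          | ℤ.*-zeroʳ (sgn s) = refl

  -- Substituting c for the variable merges the monomial of S with that of S and i together. The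
  -- restricted function keeps t arguments, which doubles the unnormalised sum and so leaves the
  -- right side without a factor 1/2.
  coeff-fix-outside : ∀ (f : BoolFn t) i c S → lookup S i ≡ false →
    coeff (f ∘ (_[ i ]≔ c)) S ≡ coeff f S + sgn c * coeff f (S [ i ]≔ inside)
  coeff-fix-outside f zero    c (false ∷ S) refl = go c
    where
    p = coeff (f ∘ (false ∷_)) S
    q = coeff (f ∘ (true ∷_)) S
    even : ∀ p q → p + 1ℤ * p ≡ p + 1ℤ * q + 1ℤ * (p + -1ℤ * q)
    even = solve-∀
    odd : ∀ p q → q + 1ℤ * q ≡ p + 1ℤ * q + -1ℤ * (p + -1ℤ * q)
    odd = solve-∀
    go : ∀ c → coeff (f ∘ (c ∷_)) S + 1ℤ * coeff (f ∘ (c ∷_)) S ≡ p + 1ℤ * q + sgn c * (p + -1ℤ * q)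
    go false = even p q
    go true  = odd p q
  coeff-fix-outside f (suc i) c (s ∷ S) eq
    rewrite coeff-fix-outside (f ∘ (false ∷_)) i c S eq | coeff-fix-outside (f ∘ (true ∷_)) i c S eq =
    rearrange (coeff (f ∘ (false ∷_)) S) (coeff (f ∘ (false ∷_)) (S [ i ]≔ inside))
              (coeff (f ∘ (true ∷_)) S) (coeff (f ∘ (true ∷_)) (S [ i ]≔ inside)) (sgn s) (sgn c)
    where
    rearrange : ∀ p p′ q q′ s c → (p + c * p′) + s * (q + c * q′) ≡ (p + s * q) + c * (p′ + s * q′)
    rearrange = solve-∀

  ∣insert∣ : ∀ (S : Subset t) i → lookup S i ≡ false → ∣ S [ i ]≔ inside ∣ ≡ suc ∣ S ∣
  ∣insert∣ (false ∷ S) zero    refl = refl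
  ∣insert∣ (false ∷ S) (suc i) eq   = ∣insert∣ S i eq
  ∣insert∣ (true ∷ S)  (suc i) eq   = cong suc (∣insert∣ S i eq)

  elements : Subset t → List (Fin t)
  elements []            = []
  elements (outside ∷ U) = L.map suc (elements U)
  elements (inside ∷ U)  = zero ∷ L.map suc (elements U)

  length-elements : (U : Subset t) → length (elements U) ≡ ∣ U ∣
  length-elements []            = refl
  length-elements (outside ∷ U) = trans (L.length-map suc (elements U)) (length-elements U)
  length-elements (inside ∷ U)  = cong suc (trans (L.length-map suc (elements U)) (length-elements U))

  avoids-elements : (S U : Subset t) → All (λ i → lookup S i ≡ false) (elements U) → ∣ S ∩ U ∣ ≡ 0
  avoids-elements []          []            _  = refl
  avoids-elements (true ∷ S)  (outside ∷ U) as = avoids-elements S U (All.map⁻ as)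
  avoids-elements (false ∷ S) (outside ∷ U) as = avoids-elements S U (All.map⁻ as)
  avoids-elements (s ∷ S)     (inside ∷ U)  (refl ∷ as) = avoids-elements S U (All.map⁻ as)

  -- Decision trees of depth at most q. A query overwrites its coordinate instead of deleting it, so
  -- the whole tree speaks about inputs of one length and later rounds may ask for the same
  -- coordinate again.
  data Decides {t} : ℕ → BoolFn t → Set where
    constant : ∀ {q f} c → (∀ z → f z ≡ c) → Decides q f
    query    : ∀ {q f} i → (∀ c → Decides q (f ∘ (_[ i ]≔ c))) → Decides (suc q) f

  Decides-mono : ∀ {q r} {f : BoolFn t} → q ℕ.≤ r → Decides q f → Decides r f
  Decides-mono le       (constant c h) = constant c h
  Decides-mono (s≤s le) (query i k)    = query i (λ c → Decides-mono le (k c))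

  -- Invariant: a set of size d avoiding the remaining list L has coefficient 0. Fixing i kills the
  -- sets containing i, and the others only receive coefficients of size d + 1, which are 0. Once L
  -- is empty the degree is below d.
  query-all : ∀ {d q} L (f : BoolFn t) → Signed f → Degree< (suc d) f →
    (∀ S → ∣ S ∣ ≡ d → All (λ i → lookup S i ≡ false) L → coeff f S ≡ 0ℤ) →
    (∀ (g : BoolFn t) → Signed g → Degree< d g → Decides q g) → Decides (length L ℕ.+ q) f
  query-all {d = d} [] f sf deg top k = k f sf lower
    where
    lower : Degree< d f
    lower S le with ℕ.m≤n⇒m<n∨m≡n le
    ... | inj₁ lt = deg S lt
    ... | inj₂ eq = top S (sym eq) []
  query-all {d = d} (i ∷ L) f sf deg top k = query i λ c →
    query-all L (f ∘ (_[ i ]≔ c)) (sf ∘ (_[ i ]≔ c)) (deg′ c) (top′ c) k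
    where
    fixed : ∀ c S → d ℕ.≤ ∣ S ∣ → (lookup S i ≡ false → coeff f S ≡ 0ℤ) → coeff (f ∘ (_[ i ]≔ c)) S ≡ 0ℤ
    fixed c S le vanish with lookup S i in eq
    ... | true  = coeff-fix-inside f i c S eq
    ... | false rewrite coeff-fix-outside f i c S eq | vanish refl
                      | deg (S [ i ]≔ inside) (subst (suc d ℕ.≤_) (sym (∣insert∣ S i eq)) (s≤s le))
                      | ℤ.*-zeroʳ (sgn c) = refl
    deg′ : ∀ c → Degree< (suc d) (f ∘ (_[ i ]≔ c))
    deg′ c S le = fixed c S (ℕ.<⇒≤ le) (λ _ → deg S le)
    top′ : ∀ c S → ∣ S ∣ ≡ d → All (λ i → lookup S i ≡ false) L → coeff (f ∘ (_[ i ]≔ c)) S ≡ 0ℤ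
    top′ c S size avoid = fixed c S (ℕ.≤-reflexive (sym size)) (λ out → top S size (out ∷ avoid))

  -- In the round for degree e there are at most 4e² leading sets, of e variables each.
  queries : ℕ → ℕ
  queries zero    = 0
  queries (suc d) = 4 ℕ.* (suc d ℕ.* suc d) ℕ.* suc d ℕ.+ queries d

  ∣⋃∣≤ : ∀ d (f : BoolFn t) {Ms} → All (Leading f d) Ms → ∣ ⋃ Ms ∣ ℕ.≤ length Ms ℕ.* d
  ∣⋃∣≤ {t} d f []                    = ℕ.≤-reflexive (∣⊥∣≡0 t)
  ∣⋃∣≤ d f {M ∷ Ms} ((size , _) ∷ leads) =
    ℕ.≤-trans (∣∪∣≤ M (⋃ Ms)) (ℕ.+-mono-≤ (ℕ.≤-reflexive size) (∣⋃∣≤ d f leads))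

  degree⇒decides : ∀ d (f : BoolFn t) → Signed f → Degree< (suc d) f → Decides (queries d) f
  degree⇒decides zero      f sf deg = constant (f ⊥) (degree<1⇒constant deg)
  degree⇒decides d@(suc e) f sf deg with maximal-packing {d = d} f (s≤s z≤n) sf deg
  ... | Ms , leads , len , maximal = Decides-mono
    (ℕ.+-monoˡ-≤ (queries e) (begin
      length (elements (⋃ Ms)) ≡⟨ length-elements (⋃ Ms) ⟩
      ∣ ⋃ Ms ∣                 ≤⟨ ∣⋃∣≤ d f leads ⟩
      length Ms ℕ.* d          ≤⟨ ℕ.*-monoˡ-≤ d len ⟩
      4 ℕ.* (d ℕ.* d) ℕ.* d    ∎))
    (query-all (elements (⋃ Ms)) f sf deg
      (λ S size avoid → maximal S size (avoids-elements S (⋃ Ms) avoid)) (degree⇒decides e))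
    where open ℕ.≤-Reasoning

  queries-bound : ∀ d → queries d ℕ.≤ 4 ℕ.* (d ℕ.* d ℕ.* d ℕ.* d)
  queries-bound zero    = z≤n
  queries-bound (suc d) = begin
    4 ℕ.* (suc d ℕ.* suc d) ℕ.* suc d ℕ.+ queries d
      ≤⟨ ℕ.+-monoʳ-≤ (4 ℕ.* (suc d ℕ.* suc d) ℕ.* suc d) (queries-bound d) ⟩
    4 ℕ.* (suc d ℕ.* suc d) ℕ.* suc d ℕ.+ 4 ℕ.* (d ℕ.* d ℕ.* d ℕ.* d)
      -- The slack is four times (d+1)⁴ - (d+1)³ - d⁴.
      ≤⟨ ℕ.m≤m+n _ (4 ℕ.* (3 ℕ.* d ℕ.* d ℕ.* d ℕ.+ 3 ℕ.* d ℕ.* d ℕ.+ d)) ⟩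
    4 ℕ.* (suc d ℕ.* suc d) ℕ.* suc d ℕ.+ 4 ℕ.* (d ℕ.* d ℕ.* d ℕ.* d) ℕ.+ 4 ℕ.* (3 ℕ.* d ℕ.* d ℕ.* d ℕ.+ 3 ℕ.* d ℕ.* d ℕ.+ d)
      ≡⟨ expand d ⟩
    4 ℕ.* (suc d ℕ.* suc d ℕ.* suc d ℕ.* suc d) ∎
    where
    open ℕ.≤-Reasoning
    expand : ∀ d → 4 ℕ.* (suc d ℕ.* suc d) ℕ.* suc d ℕ.+ 4 ℕ.* (d ℕ.* d ℕ.* d ℕ.* d) ℕ.+ 4 ℕ.* (3 ℕ.* d ℕ.* d ℕ.* d ℕ.+ 3 ℕ.* d ℕ.* d ℕ.+ d)
           ≡ 4 ℕ.* (suc d ℕ.* suc d ℕ.* suc d ℕ.* suc d)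
    expand = ℕ-Solver.solve-∀

-- Rank

toℚᵘ-toℚ : ∀ z → ℚ.toℚᵘ (toℚ z) ℚᵘ.≃ ℚᵘ.mkℚᵘ z 0
toℚᵘ-toℚ z = ℚ.toℚᵘ-fromℚᵘ (ℚᵘ.mkℚᵘ z 0)

toℚ-+ : ∀ a b → toℚ (a ℤ.+ b) ≡ toℚ a ℚ.+ toℚ b
toℚ-+ a b = ℚ.toℚᵘ-injective (ℚᵘ.≃-trans (toℚᵘ-toℚ (a ℤ.+ b)) (ℚᵘ.≃-sym
  (ℚᵘ.≃-trans (ℚ.toℚᵘ-homo-+ (toℚ a) (toℚ b)) (ℚᵘ.≃-trans
  (ℚᵘ.+-cong (toℚᵘ-toℚ a) (toℚᵘ-toℚ b))
  (ℚᵘ.*≡* (cong (ℤ._* 1ℤ) (cong₂ ℤ._+_ (ℤ.*-identityʳ a) (ℤ.*-identityʳ b))))))))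

toℚ-* : ∀ a b → toℚ (a ℤ.* b) ≡ toℚ a ℚ.* toℚ b
toℚ-* a b = ℚ.toℚᵘ-injective (ℚᵘ.≃-trans (toℚᵘ-toℚ (a ℤ.* b)) (ℚᵘ.≃-sym
  (ℚᵘ.≃-trans (ℚ.toℚᵘ-homo-* (toℚ a) (toℚ b)) (ℚᵘ.*-cong (toℚᵘ-toℚ a) (toℚᵘ-toℚ b)))))

/≡0⇒≡0 : ∀ z n .{{_ : ℕ.NonZero n}} → z ℚ./ n ≡ 0ℚ → z ≡ 0ℤ
/≡0⇒≡0 z n eq = trans (sym (ℚ.↥-/ z n)) (cong (λ q → ↥ q ℤ.* gcd z (+ n)) eq)

fhat≡0⇒coeff≡0 : ∀ (f : BoolFn t) S → fhat f S ≡ 0ℚ → coeff f S ≡ 0ℤ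
fhat≡0⇒coeff≡0 {t} f S eq = trans (sym (coeff-sum f S)) (/≡0⇒≡0 _ (2 ℕ.^ t) {{ℕ.m^n≢0 2 t}} eq)

coeff≡0⇒fhat≡0 : ∀ (f : BoolFn t) S → coeff f S ≡ 0ℤ → fhat f S ≡ 0ℚ
coeff≡0⇒fhat≡0 {t} f S eq =
  trans (cong (λ z → ℚ._/_ z (2 ℕ.^ t) {{ℕ.m^n≢0 2 t}}) (trans (coeff-sum f S) eq))
        (ℚ.0/n≡0 (2 ℕ.^ t) {{ℕ.m^n≢0 2 t}})

*-zero-cancelʳ : ∀ p {q} → q ≢ 0ℚ → p ℚ.* q ≡ 0ℚ → p ≡ 0ℚ
*-zero-cancelʳ p {q} q≢0 pq≡0 = begin
  p                        ≡⟨ ℚ.*-identityʳ p ⟨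
  p ℚ.* 1ℚ                 ≡⟨ cong (p ℚ.*_) (ℚ.*-inverseʳ q) ⟨
  p ℚ.* (q ℚ.* (ℚ.1/ q))   ≡⟨ ℚ.*-assoc p q (ℚ.1/ q) ⟨
  p ℚ.* q ℚ.* (ℚ.1/ q)     ≡⟨ cong (ℚ._* (ℚ.1/ q)) pq≡0 ⟩
  0ℚ ℚ.* (ℚ.1/ q)          ≡⟨ ℚ.*-zeroˡ (ℚ.1/ q) ⟩
  0ℚ                       ∎
  where
  open ≡-Reasoning
  instance _ = ℚ.≢-nonZero q≢0

sum-cong : ∀ k {g h : Fin k → ℚ} → (∀ j → g j ≡ h j) → sumFinℚ k g ≡ sumFinℚ k h
sum-cong zero    eq = refl
sum-cong (suc k) eq = cong₂ ℚ._+_ (eq zero) (sum-cong k (eq ∘ suc))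

sum-linear : ∀ k (g h : Fin k → ℚ) c →
             sumFinℚ k (λ j → g j ℚ.+ h j ℚ.* c) ≡ sumFinℚ k g ℚ.+ sumFinℚ k h ℚ.* c
sum-linear zero    g h c = sym (trans (ℚ.+-identityˡ _) (ℚ.*-zeroˡ c))
sum-linear (suc k) g h c = trans (cong (g zero ℚ.+ h zero ℚ.* c ℚ.+_) (sum-linear k (g ∘ suc) (h ∘ suc) c))
  (solve 5 (λ a b x y c → (a :+ b :* c) :+ (x :+ y :* c) := (a :+ x) :+ (b :+ y) :* c) refl
    (g zero) (h zero) (sumFinℚ k (g ∘ suc)) (sumFinℚ k (h ∘ suc)) c)
  where open +-*-Solver

sum-*ʳ : ∀ k (g : Fin k → ℚ) c → sumFinℚ k (λ j → g j ℚ.* c) ≡ sumFinℚ k g ℚ.* c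
sum-*ʳ zero    g c = sym (ℚ.*-zeroˡ c)
sum-*ʳ (suc k) g c =
  trans (cong (g zero ℚ.* c ℚ.+_) (sum-*ʳ k (g ∘ suc) c))
        (sym (ℚ.*-distribʳ-+ c (g zero) (sumFinℚ k (g ∘ suc))))

sum-↑ : ∀ a b (g : Fin (a ℕ.+ b) → ℚ) →
        sumFinℚ (a ℕ.+ b) g ≡ sumFinℚ a (g ∘ (_↑ˡ b)) ℚ.+ sumFinℚ b (g ∘ (a ↑ʳ_))
sum-↑ zero    b g = sym (ℚ.+-identityˡ _)
sum-↑ (suc a) b g = trans (cong (g zero ℚ.+_) (sum-↑ a b (g ∘ suc)))
  (sym (ℚ.+-assoc (g zero) (sumFinℚ a (g ∘ suc ∘ (_↑ˡ b))) (sumFinℚ b (g ∘ suc ∘ (a ↑ʳ_)))))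

sum-combine : ∀ m k (g : Fin (m ℕ.* k) → ℚ) →
              sumFinℚ (m ℕ.* k) g ≡ sumFinℚ m λ r → sumFinℚ k λ j → g (combine r j)
sum-combine zero    k g = refl
sum-combine (suc m) k g =
  trans (sum-↑ k (m ℕ.* k) g) (cong (sumFinℚ k (g ∘ (_↑ˡ (m ℕ.* k))) ℚ.+_) (sum-combine m k (g ∘ (k ↑ʳ_))))

-- The sign matrix has a first row and column of ones, and the rest is -1 on the diagonal and 1
-- elsewhere. Without the border it would be singular in size 2.
bit : Fin m → Fin m → Bool
bit zero    v       = false
bit (suc r) zero    = false
bit (suc r) (suc v) = does (r Fin.≟ v)

signedSum : ∀ k (b : Fin k → ℚ) v →
            sumFinℚ k (λ r → b r ℚ.* toℚ (sgn (does (r Fin.≟ v)))) ≡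
            sumFinℚ k b ℚ.- (b v ℚ.+ b v)
signedSum (suc k) b zero = trans
  (cong (b zero ℚ.* toℚ -1ℤ ℚ.+_) (sum-cong k (λ j → ℚ.*-identityʳ (b (suc j)))))
  (solve 2 (λ x s → x :* con (toℚ -1ℤ) :+ s := (x :+ s) :- (x :+ x)) refl (b zero) (sumFinℚ k (b ∘ suc)))
  where open +-*-Solver
signedSum (suc k) b (suc v) = trans
  (cong (b zero ℚ.* 1ℚ ℚ.+_) (signedSum k (b ∘ suc) v))
  (solve 3 (λ x s y → x :* con 1ℚ :+ (s :- (y :+ y)) := (x :+ s) :- (y :+ y)) refl
    (b zero) (sumFinℚ k (b ∘ suc)) (b (suc v)))
  where open +-*-Solver

-- The zeroth column gives total 0, and column v > 0 gives the total minus twice `b v`. So all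
-- entries but the zeroth vanish, and then that one equals the total.
bit-independent : ∀ (b : Fin m → ℚ) →
  (∀ v → sumFinℚ m (λ r → b r ℚ.* toℚ (sgn (bit r v))) ≡ 0ℚ) → ∀ r → b r ≡ 0ℚ
bit-independent {suc m} b vanish = λ where
    zero    → trans (trans (sym (ℚ.+-identityʳ _))
                (cong (b zero ℚ.+_) (sym (trans (sum-cong m rest) (sum-0 m))))) total
    (suc v) → rest v
  where
  open ≡-Reasoning
  open +-*-Solver
  total : sumFinℚ (suc m) b ≡ 0ℚ
  total = trans (sym (trans (sum-cong (suc m) column₀) (trans (sum-*ʳ (suc m) b 1ℚ) (ℚ.*-identityʳ _))))
                (vanish zero)
    where
    column₀ : ∀ r → b r ℚ.* toℚ (sgn (bit r zero)) ≡ b r ℚ.* 1ℚ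
    column₀ zero    = refl
    column₀ (suc r) = refl
  sum-0 : ∀ k → sumFinℚ k (λ _ → 0ℚ) ≡ 0ℚ
  sum-0 zero    = refl
  sum-0 (suc k) = trans (ℚ.+-identityˡ _) (sum-0 k)
  half : ∀ y → y ℚ.+ y ≡ 0ℚ → y ≡ 0ℚ
  half y eq = *-zero-cancelʳ y {toℚ (+ 2)} (λ ())
    (trans (solve 1 (λ y → y :* con (toℚ (+ 2)) := y :+ y) refl y) eq)
  rest : ∀ v → b (suc v) ≡ 0ℚ
  rest v = half y (begin
    y ℚ.+ y
      ≡⟨ solve 3 (λ x s y → y :+ y := (x :+ s) :- (x :* con 1ℚ :+ (s :- (y :+ y)))) refl
           (b zero) (sumFinℚ m (b ∘ suc)) y ⟩
    sumFinℚ (suc m) b ℚ.- (b zero ℚ.* 1ℚ ℚ.+ (sumFinℚ m (b ∘ suc) ℚ.- (y ℚ.+ y)))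
      ≡⟨ cong (λ s → sumFinℚ (suc m) b ℚ.- (b zero ℚ.* 1ℚ ℚ.+ s)) (signedSum m (b ∘ suc) v) ⟨
    sumFinℚ (suc m) b ℚ.- sumFinℚ (suc m) (λ r → b r ℚ.* toℚ (sgn (bit r (suc v))))
      ≡⟨ cong₂ ℚ._-_ total (vanish (suc v)) ⟩
    0ℚ ∎)
    where y = b (suc v)

-- Kronecker powers of the sign matrix

select : (Fin t → Fin m → Bool) → Vec (Fin m) t → Vec Bool t
select X V = tabulate λ i → X i (lookup V i)

-- On the blocks met by S the rows run over all tuples of rows of the
-- nonsingular matrix (-1)^bit, so the submatrix is a Kronecker power of it.
rowOf : (S : Subset t) → Fin (m ℕ.^ ∣ S ∣) → Fin t → Fin m → Bool
rowOf (outside ∷ S) j zero    = λ _ → false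
rowOf (outside ∷ S) j (suc i) = rowOf S j i
rowOf {m = m} (inside ∷ S) j zero    = bit (proj₁ (remQuot {m} (m ℕ.^ ∣ S ∣) j))
rowOf {m = m} (inside ∷ S) j (suc i) = rowOf S (proj₂ (remQuot {m} (m ℕ.^ ∣ S ∣) j)) i

-- A row index in the Kronecker product is a pair (r, j′). For fixed offsets V in the later blocks,
-- the inner sums over j′ form a relation between the rows r of the small matrix, so they vanish;
-- the induction hypothesis applies to them as V varies.
rows-independent : ∀ (S : Subset t) (a : Fin (suc m ℕ.^ ∣ S ∣) → ℚ) →
  (∀ V → sumFinℚ _ (λ j → a j ℚ.* toℚ (chi S (select (rowOf {m = suc m} S j) V))) ≡ 0ℚ) →
  ∀ j → a j ≡ 0ℚ
rows-independent [] a vanish zero =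
  trans (sym (trans (ℚ.+-identityʳ _) (ℚ.*-identityʳ _))) (vanish [])
-- The character ignores this block, so any offset serves; `zero` exists because the block size is
-- positive.
rows-independent (outside ∷ S) a vanish = rows-independent S a λ V → vanish (zero ∷ V)
rows-independent {m = m} (inside ∷ S) a vanish j = begin
  a j                                           ≡⟨ cong a (Fin.combine-remQuot {suc m} k j) ⟨
  a (combine (proj₁ (remQuot {suc m} k j)) (proj₂ (remQuot {suc m} k j)))
    ≡⟨ rows-independent S (λ j′ → a (combine (proj₁ (remQuot {suc m} k j)) j′))
         (λ V → bit-independent (inner V) (λ v → trans (expand v V) (vanish (v ∷ V)))
                  (proj₁ (remQuot {suc m} k j)))
         (proj₂ (remQuot {suc m} k j)) ⟩
  0ℚ ∎
  where
  open ≡-Reasoning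
  k = suc m ℕ.^ ∣ S ∣
  inner : Vec (Fin (suc m)) _ → Fin (suc m) → ℚ
  inner V r = sumFinℚ k λ j′ → a (combine r j′) ℚ.* toℚ (chi S (select (rowOf S j′) V))
  term : ∀ v V r j′ →
    a (combine r j′) ℚ.* toℚ (chi S (select (rowOf S j′) V)) ℚ.* toℚ (sgn (bit r v)) ≡
    a (combine r j′) ℚ.* toℚ (chi (inside ∷ S) (select (rowOf (inside ∷ S) (combine r j′)) (v ∷ V)))
  term v V r j′ = begin
    x ℚ.* toℚ χ ℚ.* toℚ (sgn (bit r v))
      ≡⟨ solve 3 (λ x y z → x :* y :* z := x :* (z :* y)) refl x (toℚ χ) (toℚ (sgn (bit r v))) ⟩
    x ℚ.* (toℚ (sgn (bit r v)) ℚ.* toℚ χ)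
      ≡⟨ cong (x ℚ.*_) (toℚ-* (sgn (bit r v)) χ) ⟨
    x ℚ.* toℚ (sgn (bit r v) ℤ.* χ)
      ≡⟨ cong (λ s → x ℚ.* toℚ s) (sgn-xor (bit r v) (parity S (select (rowOf S j′) V))) ⟨
    x ℚ.* toℚ (rowChi (r , j′))
      ≡⟨ cong (λ p → x ℚ.* toℚ (rowChi p)) (Fin.remQuot-combine {suc m} r j′) ⟨
    x ℚ.* toℚ (chi (inside ∷ S) (select (rowOf (inside ∷ S) (combine r j′)) (v ∷ V))) ∎
    where
    open +-*-Solver
    x = a (combine r j′)
    χ = chi S (select (rowOf {m = suc m} S j′) V)
    rowChi : Fin (suc m) × Fin k → ℤ
    rowChi (r , j) = chi (inside ∷ S) (bit r v ∷ select (rowOf S j) V)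
  expand : ∀ v V → sumFinℚ (suc m) (λ r → inner V r ℚ.* toℚ (sgn (bit r v))) ≡
    sumFinℚ _ (λ j → a j ℚ.* toℚ (chi (inside ∷ S) (select (rowOf {m = suc m} (inside ∷ S) j) (v ∷ V))))
  expand v V = sym (trans (sum-combine (suc m) k _) (sum-cong (suc m) λ r →
    trans (sum-cong k (λ j′ → sym (term v V r j′)))
          (sum-*ʳ k (λ j′ → a (combine r j′) ℚ.* toℚ (chi S (select (rowOf S j′) V))) _)))

-- This is the averaging over w: a relation between rows of the pattern matrix passes to their
-- Fourier coefficients in w.
coeff-combination : ∀ {k} (a : Fin k → ℚ) (g : Fin k → BoolFn t) →
  (∀ z → sumFinℚ k (λ j → a j ℚ.* toℚ (g j z)) ≡ 0ℚ) →
  ∀ S → sumFinℚ k (λ j → a j ℚ.* toℚ (coeff (g j) S)) ≡ 0ℚ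
coeff-combination a g vanish []      = vanish []
coeff-combination {k = k} a g vanish (s ∷ S) = begin
  sumFinℚ k (λ j → a j ℚ.* toℚ (coeff (g j) (s ∷ S)))
    ≡⟨ sum-cong k distribute ⟩
  sumFinℚ k (λ j → part false j ℚ.+ part true j ℚ.* toℚ (sgn s))
    ≡⟨ sum-linear k (part false) (part true) (toℚ (sgn s)) ⟩
  sumFinℚ k (part false) ℚ.+ sumFinℚ k (part true) ℚ.* toℚ (sgn s)
    ≡⟨ cong₂ (λ p q → p ℚ.+ q ℚ.* toℚ (sgn s)) (part≡0 false) (part≡0 true) ⟩
  0ℚ ℚ.+ 0ℚ ℚ.* toℚ (sgn s)
    ≡⟨ trans (ℚ.+-identityˡ _) (ℚ.*-zeroˡ (toℚ (sgn s))) ⟩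
  0ℚ ∎
  where
  open ≡-Reasoning
  open +-*-Solver
  part : Bool → Fin k → ℚ
  part b j = a j ℚ.* toℚ (coeff (g j ∘ (b ∷_)) S)
  part≡0 : ∀ b → sumFinℚ k (part b) ≡ 0ℚ
  part≡0 b = coeff-combination a (λ j → g j ∘ (b ∷_)) (λ z → vanish (b ∷ z)) S
  distribute : ∀ j → a j ℚ.* toℚ (coeff (g j) (s ∷ S)) ≡ part false j ℚ.+ part true j ℚ.* toℚ (sgn s)
  distribute j
    rewrite toℚ-+ (coeff (g j ∘ (false ∷_)) S) (sgn s ℤ.* coeff (g j ∘ (true ∷_)) S)
          | toℚ-* (sgn s) (coeff (g j ∘ (true ∷_)) S)
    = solve 4 (λ x p y q → x :* (p :+ y :* q) := x :* p :+ x :* q :* y) refl (a j) _ (toℚ (sgn s)) _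

-- Inputs with prescribed blocks

realise : t ℕ.* m ≡ n → (Fin t → Fin m → Bool) → Vec Bool n
realise {t} {m} eq X =
  tabulate λ p → X (proj₁ (remQuot {t} m (cast (sym eq) p))) (proj₂ (remQuot {t} m (cast (sym eq) p)))

restrict-realise : (eq : t ℕ.* m ≡ n) (X : Fin t → Fin m → Bool) (V : Vec (Fin m) t) →
                   restrict eq (realise eq X) V ≡ select X V
restrict-realise {t} {m} eq X V = V.tabulate-cong λ i → trans
  (V.lookup∘tabulate _ (cast eq (combine i (lookup V i))))
  (cong (λ p → X (proj₁ p) (proj₂ p)) (trans
    (cong (remQuot {t} m) (Fin.cast-involutive (sym eq) eq (combine i (lookup V i))))
    (Fin.remQuot-combine i (lookup V i))))

rank-bound : (eq : t ℕ.* suc m ≡ n) (f : BoolFn t) (S : Subset t) → coeff f S ≢ 0ℤ →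
             RankAtLeast (patternMatrix eq f) (suc m ℕ.^ ∣ S ∣)
rank-bound {m = m} eq f S cS≢0 = (realise eq ∘ rowOf S) , λ a vanish →
  rows-independent S a λ V → *-zero-cancelʳ _ (cS≢0 ∘ /≡0⇒≡0 _ 1) (begin
    sumFinℚ k (λ j → a j ℚ.* χ V j) ℚ.* toℚ (coeff f S)
      ≡⟨ sum-*ʳ k _ _ ⟨
    sumFinℚ k (λ j → a j ℚ.* χ V j ℚ.* toℚ (coeff f S))
      ≡⟨ sum-cong k (λ j → trans (ℚ.*-assoc (a j) _ _) (cong (a j ℚ.*_) (character V j))) ⟩
    sumFinℚ k (λ j → a j ℚ.* toℚ (coeff (λ w → f (restrict eq (row j) V ⊕ w)) S))
      ≡⟨ coeff-combination a (λ j w → f (restrict eq (row j) V ⊕ w)) (λ w → vanish (V , w)) S ⟩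
    0ℚ ∎)
  where
  open ≡-Reasoning
  k = suc m ℕ.^ ∣ S ∣
  row : Fin k → Vec Bool _
  row = realise eq ∘ rowOf S
  χ : Vec (Fin (suc m)) _ → Fin k → ℚ
  χ V j = toℚ (chi S (select (rowOf S j) V))
  character : ∀ V j → χ V j ℚ.* toℚ (coeff f S) ≡ toℚ (coeff (λ w → f (restrict eq (row j) V ⊕ w)) S)
  character V j = begin
    χ V j ℚ.* toℚ (coeff f S) ≡⟨ toℚ-* (chi S (select (rowOf S j) V)) (coeff f S) ⟨
    toℚ (chi S (select (rowOf S j) V) ℤ.* coeff f S)
      ≡⟨ cong (λ y → toℚ (chi S y ℤ.* coeff f S)) (restrict-realise eq (rowOf S j) V) ⟨
    toℚ (chi S (restrict eq (row j) V) ℤ.* coeff f S)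
      ≡⟨ cong toℚ (coeff-shift f (restrict eq (row j) V) S) ⟨
    toℚ (coeff (λ w → f (restrict eq (row j) V ⊕ w)) S) ∎

-- Protocols simulating decision trees

-- Bob announces `g y` in L bits, most significant first. The continuation is indexed by all of ℕ,
-- so that no range proofs travel with the protocol.
send : (L : ℕ) → (Y → ℕ) → (ℕ → Protocol X Y O) → Protocol X Y O
send zero    g R = R 0
send (suc L) g R = bob (λ y → 2 ℕ.^ L ℕ.≤ᵇ g y)
  (send L (λ y → g y ℕ.∸ 2 ℕ.^ L) (λ k → R (2 ℕ.^ L ℕ.+ k)))
  (send L g R)

run-send : ∀ L (g : Y → ℕ) (R : ℕ → Protocol X Y O) x y → g y ℕ.< 2 ℕ.^ L →
           run (send L g R) x y ≡ run (R (g y)) x y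
run-send zero    g R x y lt = cong (λ k → run (R k) x y) (sym (ℕ.n<1⇒n≡0 lt))
run-send (suc L) g R x y lt with 2 ℕ.^ L ℕ.≤ᵇ g y | ℕ.≤ᵇ-reflects-≤ (2 ℕ.^ L) (g y)
... | false | ofⁿ ≰  = run-send L g R x y (ℕ.≰⇒> ≰)
... | true  | ofʸ le = trans
  (run-send L (λ y → g y ℕ.∸ 2 ℕ.^ L) (λ k → R (2 ℕ.^ L ℕ.+ k)) x y
    (ℕ.+-cancelˡ-< (2 ℕ.^ L) _ _ (subst₂ ℕ._<_ (sym (ℕ.m+[n∸m]≡n le))
      (cong (2 ℕ.^ L ℕ.+_) (ℕ.+-identityʳ (2 ℕ.^ L))) lt)))
  (cong (λ k → run (R k) x y) (ℕ.m+[n∸m]≡n le))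

depth-send : ∀ L (g : Y → ℕ) (R : ℕ → Protocol X Y O) {q} → (∀ k → depth (R k) ℕ.≤ q) →
             depth (send L g R) ℕ.≤ L ℕ.+ q
depth-send zero    g R le = le 0
depth-send (suc L) g R le = s≤s (ℕ.⊔-lub
  (depth-send L (λ y → g y ℕ.∸ 2 ℕ.^ L) (λ k → R (2 ℕ.^ L ℕ.+ k)) (λ k → le (2 ℕ.^ L ℕ.+ k)))
  (depth-send L g R le))

bitAt : t ℕ.* m ≡ n → Fin t → ℕ → Vec Bool n → Bool
bitAt {m = m} eq i v x with v <? m
... | yes v<m = lookup x (cast eq (combine i (fromℕ< v<m)))
-- A filler for indices from m on, which Bob never announces.
... | no _    = false

bitAt-toℕ : (eq : t ℕ.* m ≡ n) (i : Fin t) (v : Fin m) (x : Vec Bool n) →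
            bitAt eq i (toℕ v) x ≡ lookup x (cast eq (combine i v))
bitAt-toℕ {m = m} eq i v x with toℕ v <? m
... | yes v<m = cong (λ v → lookup x (cast eq (combine i v))) (Fin.fromℕ<-toℕ v v<m)
... | no ≮    = contradiction (Fin.toℕ<n v) ≮

if-run : ∀ (P : Bool → Protocol X Y O) x y b →
         (if b then run (P true) x y else run (P false) x y) ≡ run (P b) x y
if-run P x y true  = refl
if-run P x y false = refl

module Simulation (eq : t ℕ.* m ≡ n) (L : ℕ) (m≤2^L : m ℕ.≤ 2 ℕ.^ L) where

  -- Bob reveals his mask bit first, so that Alice's reply is the queried bit of `x|_V ⊕ w` itself
  -- and selects the subtree for both players.
  answer : Fin t → (Bool → Protocol (Vec Bool n) (Column t m) ℤ) → ℕ → Protocol (Vec Bool n) (Column t m) ℤ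
  answer i P v = bob (λ (V , w) → lookup w i) (reply true) (reply false)
    where
    reply : Bool → Protocol (Vec Bool n) (Column t m) ℤ
    reply b = alice (λ x → bitAt eq i v x xor b) (P true) (P false)

  query-protocol : Fin t → (Bool → Protocol (Vec Bool n) (Column t m) ℤ) → Protocol (Vec Bool n) (Column t m) ℤ
  query-protocol i P = send L (λ (V , w) → toℕ (lookup V i)) (answer i P)

  run-answer : ∀ i P v x V w → run (answer i P v) x (V , w) ≡ run (P (bitAt eq i v x xor lookup w i)) x (V , w)
  run-answer i P v x V w with lookup w i
  ... | true  = if-run P x (V , w) (bitAt eq i v x xor true)
  ... | false = if-run P x (V , w) (bitAt eq i v x xor false)

  run-query : ∀ i P x V w →
    run (query-protocol i P) x (V , w) ≡ run (P (lookup (restrict eq x V ⊕ w) i)) x (V , w)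
  run-query i P x V w = begin
    run (query-protocol i P) x (V , w)
      ≡⟨ run-send L (λ (V , w) → toℕ (lookup V i)) (answer i P) x (V , w) (ℕ.<-≤-trans (Fin.toℕ<n (lookup V i)) m≤2^L) ⟩
    run (answer i P (toℕ (lookup V i))) x (V , w)
      ≡⟨ run-answer i P (toℕ (lookup V i)) x V w ⟩
    run (P (bitAt eq i (toℕ (lookup V i)) x xor lookup w i)) x (V , w)
      ≡⟨ cong (λ b → run (P (b xor lookup w i)) x (V , w)) (trans (bitAt-toℕ eq i (lookup V i) x)
           (sym (V.lookup∘tabulate (λ i → lookup x (cast eq (combine i (lookup V i)))) i))) ⟩
    run (P (lookup (restrict eq x V) i xor lookup w i)) x (V , w)
      ≡⟨ cong (λ b → run (P b) x (V , w)) (V.lookup-zipWith _xor_ i (restrict eq x V) w) ⟨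
    run (P (lookup (restrict eq x V ⊕ w) i)) x (V , w) ∎
    where open ≡-Reasoning

  depth-query : ∀ i P {q} → (∀ b → depth (P b) ℕ.≤ q) → depth (query-protocol i P) ℕ.≤ L ℕ.+ (2 ℕ.+ q)
  depth-query i P {q} le = depth-send L (λ (V , w) → toℕ (lookup V i)) (answer i P) λ v → s≤s (ℕ.⊔-lub children children)
    where
    children : suc (depth (P true) ℕ.⊔ depth (P false)) ℕ.≤ suc q
    children = s≤s (ℕ.⊔-lub (le true) (le false))

  simulate : ∀ {q f} → Decides q f → Σ (Protocol (Vec Bool n) (Column t m) ℤ) λ P →
             Computes P (patternMatrix eq f) × depth P ℕ.≤ q ℕ.* (L ℕ.+ 2)
  simulate (constant c h) = leaf c , (λ x (V , w) → sym (h (restrict eq x V ⊕ w))) , z≤n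
  simulate {suc q} {f} (query i k) = query-protocol i P , correct ,
    subst (depth (query-protocol i P) ℕ.≤_) (sym (ℕ.+-assoc L 2 (q ℕ.* (L ℕ.+ 2))))
      (depth-query i P (λ c → proj₂ (proj₂ (simulate (k c)))))
    where
    P : Bool → Protocol (Vec Bool n) (Column t m) ℤ
    P c = proj₁ (simulate (k c))
    correct : Computes (query-protocol i P) (patternMatrix eq f)
    correct x (V , w) = trans (run-query i P x V w) (trans
      (proj₁ (proj₂ (simulate (k (lookup (restrict eq x V ⊕ w) i)))) x (V , w))
      (cong f (V.[]≔-lookup (restrict eq x V ⊕ w) i)))

binary-log : ∀ m → 0 ℕ.< m → ∃ λ ℓ → 2 ℕ.^ ℓ ℕ.≤ m × m ℕ.< 2 ℕ.^ suc ℓ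
binary-log 1 _ = 0 , s≤s z≤n , s≤s (s≤s z≤n)
binary-log (suc m@(suc _)) _ with binary-log m (s≤s z≤n)
... | ℓ , lo , hi with suc m <? 2 ℕ.^ suc ℓ
...   | yes lt = ℓ , ℕ.m≤n⇒m≤1+n lo , lt
...   | no ≮   = suc ℓ , ℕ.≮⇒≥ ≮ , ℕ.≤-<-trans hi (ℕ.^-monoʳ-< 2 (s≤s (s≤s z≤n)) (ℕ.n<1+n (suc ℓ)))

-- The exponential series

-- K (K+1) ⋯ (K+k-1) / k!, the coefficient of x^k in (1 - x)^(-K).
multichoose : ℕ → ℕ → ℕ
multichoose zero    zero    = 1
multichoose zero    (suc k) = 0
multichoose (suc K) zero    = 1
multichoose (suc K) (suc k) = multichoose K (suc k) ℕ.+ multichoose (suc K) k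

multichoose-0 : ∀ K → multichoose K 0 ≡ 1
multichoose-0 zero    = refl
multichoose-0 (suc K) = refl

-- The exact factor is K + k in place of K. In this weaker form the coefficients of (1 - x)^(-K)
-- grow at least as fast as those of exp(Kx).
multichoose-ratio : ∀ K k → K ℕ.* multichoose K k ℕ.≤ suc k ℕ.* multichoose K (suc k)
multichoose-ratio zero    k       = z≤n
multichoose-ratio (suc K) zero    = begin
  suc K ℕ.* 1                          ≡⟨ ℕ.+-comm 1 (K ℕ.* 1) ⟩
  K ℕ.* 1 ℕ.+ 1                        ≡⟨ cong (λ c → K ℕ.* c ℕ.+ 1) (multichoose-0 K) ⟨
  K ℕ.* multichoose K 0 ℕ.+ 1          ≤⟨ ℕ.+-monoˡ-≤ 1 (multichoose-ratio K 0) ⟩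
  1 ℕ.* multichoose K 1 ℕ.+ 1          ≡⟨ ℕ.*-distribˡ-+ 1 (multichoose K 1) 1 ⟨
  1 ℕ.* (multichoose K 1 ℕ.+ 1)        ∎
  where open ℕ.≤-Reasoning
multichoose-ratio (suc K) (suc k) = begin
  suc K ℕ.* w                                      ≡⟨ split K p v ⟩
  w ℕ.+ K ℕ.* p ℕ.+ K ℕ.* v
    ≤⟨ ℕ.+-mono-≤ (ℕ.+-monoʳ-≤ w (multichoose-ratio K (suc k))) (ℕ.≤-trans (ℕ.*-monoˡ-≤ v (ℕ.n≤1+n K)) (multichoose-ratio (suc K) k)) ⟩
  w ℕ.+ suc (suc k) ℕ.* r ℕ.+ suc k ℕ.* w          ≡⟨ join k w r ⟩
  suc (suc k) ℕ.* (r ℕ.+ w)                        ∎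
  where
  open ℕ.≤-Reasoning
  p = multichoose K (suc k)
  r = multichoose K (suc (suc k))
  v = multichoose (suc K) k
  w = multichoose (suc K) (suc k)
  split : ∀ K p v → suc K ℕ.* (p ℕ.+ v) ≡ (p ℕ.+ v) ℕ.+ K ℕ.* p ℕ.+ K ℕ.* v
  split = ℕ-Solver.solve-∀
  join : ∀ k w r → w ℕ.+ suc (suc k) ℕ.* r ℕ.+ suc k ℕ.* w ≡ suc (suc k) ℕ.* (r ℕ.+ w)
  join = ℕ-Solver.solve-∀

ι : ℕ → ℚ
ι n = toℚ (+ n)

ι-+ : ∀ a b → ι (a ℕ.+ b) ≡ ι a ℚ.+ ι b
ι-+ a b = toℚ-+ (+ a) (+ b)

ι-* : ∀ a b → ι (a ℕ.* b) ≡ ι a ℚ.* ι b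
ι-* a b = trans (cong toℚ (ℤ.pos-* a b)) (toℚ-* (+ a) (+ b))

0≤ι : ∀ n → 0ℚ ℚ.≤ ι n
0≤ι n = ℚ.nonNegative⁻¹ (ι n) {{ℚ.normalize-nonNeg n 1}}

ι-mono : ∀ {a b} → a ℕ.≤ b → ι a ℚ.≤ ι b
ι-mono {a} a≤b with ℕ.m≤n⇒∃[o]m+o≡n a≤b
... | o , refl = subst₂ ℚ._≤_ (ℚ.+-identityʳ (ι a)) (sym (ι-+ a o)) (ℚ.+-monoʳ-≤ (ι a) (0≤ι o))

ι-inverse : ∀ k → ι (suc k) ℚ.* (+ 1 ℚ./ suc k) ≡ 1ℚ
ι-inverse k = ℚ.toℚᵘ-injective (ℚᵘ.≃-trans (ℚ.toℚᵘ-homo-* (ι (suc k)) (+ 1 ℚ./ suc k))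
  (ℚᵘ.≃-trans (ℚᵘ.*-cong (toℚᵘ-toℚ (+ suc k)) (ℚ.toℚᵘ-fromℚᵘ (ℚᵘ.mkℚᵘ (+ 1) k)))
  (ℚᵘ.*≡* (trans (ℤ.*-identityʳ _) (trans (ℤ.*-identityʳ _) (sym (trans (ℤ.*-identityˡ _) (cong (+_) (ℕ.*-identityˡ (suc k))))))))))

*-mono : ∀ {p p′ q q′} → 0ℚ ℚ.≤ q → 0ℚ ℚ.≤ p′ → p ℚ.≤ p′ → q ℚ.≤ q′ → p ℚ.* q ℚ.≤ p′ ℚ.* q′
*-mono {p} {p′} {q} {q′} 0≤q 0≤p′ p≤ q≤ = ℚ.≤-trans
  (ℚ.*-monoʳ-≤-nonNeg q {{ℚ.nonNegative 0≤q}} p≤) (ℚ.*-monoˡ-≤-nonNeg p′ {{ℚ.nonNegative 0≤p′}} q≤)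

*-nonNeg : ∀ {p q} → 0ℚ ℚ.≤ p → 0ℚ ℚ.≤ q → 0ℚ ℚ.≤ p ℚ.* q
*-nonNeg {p} {q} 0≤p 0≤q = subst (ℚ._≤ p ℚ.* q) (ℚ.*-zeroˡ q) (*-mono 0≤q 0≤p 0≤p ℚ.≤-refl)

½^ : ℕ → ℚ
½^ zero    = 1ℚ
½^ (suc k) = ½ ℚ.* ½^ k

0≤½ : 0ℚ ℚ.≤ ½
0≤½ = ℚ.nonNegative⁻¹ ½

0≤½^ : ∀ k → 0ℚ ℚ.≤ ½^ k
0≤½^ zero    = 0≤ι 1
0≤½^ (suc k) = *-nonNeg 0≤½ (0≤½^ k)

term : ℕ → ℕ → ℚ
term K k = ι (multichoose K k) ℚ.* ½^ k

0≤term : ∀ K k → 0ℚ ℚ.≤ term K k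
0≤term K k = *-nonNeg (0≤ι (multichoose K k)) (0≤½^ k)

partialSum : ℕ → ℕ → ℚ
partialSum K zero    = 0ℚ
partialSum K (suc N) = term K N ℚ.+ partialSum K N

term-0 : ∀ K → term K 0 ≡ 1ℚ
term-0 K = trans (cong (λ c → ι c ℚ.* 1ℚ) (multichoose-0 K)) (ℚ.*-identityʳ 1ℚ)

term-suc : ∀ K k → term (suc K) (suc k) ≡ term K (suc k) ℚ.+ ½ ℚ.* term (suc K) k
term-suc K k rewrite ι-+ (multichoose K (suc k)) (multichoose (suc K) k) =
  solve 4 (λ a b h x → (a :+ b) :* (h :* x) := a :* (h :* x) :+ h :* (b :* x)) refl
    (ι (multichoose K (suc k))) (ι (multichoose (suc K) k)) ½ (½^ k)
  where open +-*-Solver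

-- The truncated form of (1-x)^(-K-1) = (1-x)^(-K) + x (1-x)^(-K-1) at x = 1/2.
partialSum-suc : ∀ K N → partialSum (suc K) (suc N) ≡ partialSum K (suc N) ℚ.+ ½ ℚ.* partialSum (suc K) N
partialSum-suc K zero    rewrite term-0 K | term-0 (suc K) = refl
partialSum-suc K (suc N) = trans
  (cong₂ ℚ._+_ (term-suc K N) (partialSum-suc K N))
  (solve 5 (λ a b c d h → (a :+ h :* b) :+ (c :+ h :* d) := (a :+ c) :+ h :* (b :+ d)) refl
    (term K (suc N)) (term (suc K) N) (partialSum K (suc N)) (partialSum (suc K) N) ½)
  where open +-*-Solver

ι-double : ∀ n → ½ ℚ.* ι (2 ℕ.* n) ≡ ι n
ι-double n = trans (cong (½ ℚ.*_) (ι-* 2 n)) (trans (sym (ℚ.*-assoc ½ (ι 2) (ι n))) (ℚ.*-identityˡ (ι n)))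

-- The whole series is (1 - 1/2)^(-K) = 2^K.
partialSum-bound : ∀ K N → partialSum K N ℚ.≤ ι (2 ℕ.^ K)
partialSum-bound K       zero    = 0≤ι (2 ℕ.^ K)
partialSum-bound zero    (suc N) = ℚ.≤-reflexive (total N)
  where
  total : ∀ N → partialSum 0 (suc N) ≡ 1ℚ
  total zero    = refl
  total (suc N) rewrite ℚ.*-zeroˡ (½^ (suc N)) = trans (ℚ.+-identityˡ _) (total N)
partialSum-bound (suc K) (suc N) = begin
  partialSum (suc K) (suc N)                               ≡⟨ partialSum-suc K N ⟩
  partialSum K (suc N) ℚ.+ ½ ℚ.* partialSum (suc K) N
    ≤⟨ ℚ.+-mono-≤ (partialSum-bound K (suc N)) (ℚ.*-monoˡ-≤-nonNeg ½ (partialSum-bound (suc K) N)) ⟩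
  ι (2 ℕ.^ K) ℚ.+ ½ ℚ.* ι (2 ℕ.^ suc K)                    ≡⟨ cong (ι (2 ℕ.^ K) ℚ.+_) (ι-double (2 ℕ.^ K)) ⟩
  ι (2 ℕ.^ K) ℚ.+ ι (2 ℕ.^ K)                              ≡⟨ ι-+ (2 ℕ.^ K) (2 ℕ.^ K) ⟨
  ι (2 ℕ.^ K ℕ.+ 2 ℕ.^ K)                                  ≡⟨ cong (λ x → ι (2 ℕ.^ K ℕ.+ x)) (ℕ.+-identityʳ (2 ℕ.^ K)) ⟨
  ι (2 ℕ.^ suc K)                                          ∎
  where open ℚ.≤-Reasoning

-- expLoop names the local function of expPartial: in `unroll` the arguments of
-- that function are abstracted to variables, so unification can solve for it.
mutual
  expLoop : ℚ → ℕ → ℕ → ℚ → ℕ → ℚ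
  expLoop = _

  data Unrolled (q : ℚ) (M N : ℕ) (o x : ℚ) (k : ℕ) : ℚ → Set where
    unrolled : Unrolled q M N o x k (o ℚ.+ expLoop q M N x k)

  unroll : ∀ q N → Unrolled q (suc N) N 1ℚ (1ℚ ℚ.* q ℚ.* 1ℚ) 1 (expPartial q (suc N))
  unroll q N with 1ℚ ℚ.* q ℚ.* 1ℚ
  ... | x with 1ℚ
  ... | o with suc N | 1
  ... | M | k = unrolled

-- Termwise comparison of exp(K/2) with (1 - 1/2)^(-K). The invariant is that the running term x is
-- at most `term K k`, and `multichoose-ratio` carries it to k + 1.
expLoop-bound : ∀ K q M r x k → 0ℚ ℚ.≤ q → q ℚ.≤ ι K ℚ.* ½ → x ℚ.≤ term K k →
                expLoop q M r x k ℚ.+ partialSum K k ℚ.≤ partialSum K (r ℕ.+ k)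
expLoop-bound K q M zero    x k 0≤q q≤ x≤ = ℚ.≤-reflexive (ℚ.+-identityˡ (partialSum K k))
expLoop-bound K q M (suc r) x k 0≤q q≤ x≤ = begin
  (x ℚ.+ rest) ℚ.+ partialSum K k
    ≡⟨ solve 3 (λ x r s → (x :+ r) :+ s := r :+ (x :+ s)) refl x rest (partialSum K k) ⟩
  rest ℚ.+ (x ℚ.+ partialSum K k)        ≤⟨ ℚ.+-monoʳ-≤ rest (ℚ.+-monoˡ-≤ (partialSum K k) x≤) ⟩
  rest ℚ.+ partialSum K (suc k)          ≤⟨ expLoop-bound K q M r x′ (suc k) 0≤q q≤ x′≤ ⟩
  partialSum K (r ℕ.+ suc k)             ≡⟨ cong (partialSum K) (ℕ.+-suc r k) ⟩
  partialSum K (suc r ℕ.+ k)             ∎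
  where
  open ℚ.≤-Reasoning
  open +-*-Solver
  i = + 1 ℚ./ suc k
  x′ = x ℚ.* q ℚ.* i
  rest = expLoop q M r x′ (suc k)
  0≤i : 0ℚ ℚ.≤ i
  0≤i = ℚ.nonNegative⁻¹ i {{ℚ.normalize-nonNeg 1 (suc k)}}
  x′≤ : x′ ℚ.≤ term K (suc k)
  x′≤ = begin
    x ℚ.* q ℚ.* i
      ≤⟨ ℚ.*-monoʳ-≤-nonNeg i {{ℚ.nonNegative 0≤i}} (*-mono 0≤q (0≤term K k) x≤ q≤) ⟩
    ι (multichoose K k) ℚ.* ½^ k ℚ.* (ι K ℚ.* ½) ℚ.* i
      ≡⟨ solve 5 (λ c h K ½ i → c :* h :* (K :* ½) :* i := K :* c :* (½ :* h :* i)) refl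
           (ι (multichoose K k)) (½^ k) (ι K) ½ i ⟩
    ι K ℚ.* ι (multichoose K k) ℚ.* (½^ (suc k) ℚ.* i)
      ≡⟨ cong (ℚ._* (½^ (suc k) ℚ.* i)) (ι-* K (multichoose K k)) ⟨
    ι (K ℕ.* multichoose K k) ℚ.* (½^ (suc k) ℚ.* i)
      ≤⟨ ℚ.*-monoʳ-≤-nonNeg (½^ (suc k) ℚ.* i) {{ℚ.nonNegative (*-nonNeg (0≤½^ (suc k)) 0≤i)}} (ι-mono (multichoose-ratio K k)) ⟩
    ι (suc k ℕ.* multichoose K (suc k)) ℚ.* (½^ (suc k) ℚ.* i)
      ≡⟨ cong (ℚ._* (½^ (suc k) ℚ.* i)) (ι-* (suc k) (multichoose K (suc k))) ⟩
    ι (suc k) ℚ.* ι (multichoose K (suc k)) ℚ.* (½^ (suc k) ℚ.* i)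
      ≡⟨ solve 4 (λ s c h i → s :* c :* (h :* i) := s :* i :* (c :* h)) refl
           (ι (suc k)) (ι (multichoose K (suc k))) (½^ (suc k)) i ⟩
    ι (suc k) ℚ.* i ℚ.* term K (suc k)
      ≡⟨ cong (ℚ._* term K (suc k)) (ι-inverse k) ⟩
    1ℚ ℚ.* term K (suc k)
      ≡⟨ ℚ.*-identityˡ _ ⟩
    term K (suc k) ∎

expPartial-bound : ∀ K q N → 0ℚ ℚ.≤ q → q ℚ.≤ ι K ℚ.* ½ → expPartial q N ℚ.≤ ι (2 ℕ.^ K)
expPartial-bound K q N 0≤q q≤ = begin
  expPartial q N                             ≡⟨ ℚ.+-identityʳ (expPartial q N) ⟨
  expLoop q N N 1ℚ 0 ℚ.+ partialSum K 0
    ≤⟨ expLoop-bound K q N N 1ℚ 0 0≤q q≤ (ℚ.≤-reflexive (sym (term-0 K))) ⟩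
  partialSum K (N ℕ.+ 0)                     ≤⟨ partialSum-bound K (N ℕ.+ 0) ⟩
  ι (2 ℕ.^ K)                                ∎
  where open ℚ.≤-Reasoning

-- Comparing fourth powers

square-mono-< : ∀ {y q} → 0ℚ ℚ.≤ y → y ℚ.< q → y ℚ.* y ℚ.< q ℚ.* q
square-mono-< {y} {q} 0≤y y<q = ℚ.≤-<-trans
  (ℚ.*-monoˡ-≤-nonNeg y {{ℚ.nonNegative 0≤y}} (ℚ.<⇒≤ y<q))
  (ℚ.*-monoˡ-<-pos q {{ℚ.positive (ℚ.≤-<-trans 0≤y y<q)}} y<q)

¼ : ℚ
¼ = + 1 ℚ./ 4

-- From D ≤ (2K)⁴ it follows that a quarter of the fourth root of D is at most K/2. Roots are
-- avoided by contraposition: q > K/2 would give q⁴ > K⁴/16, which is (1/4)⁴ · 16K⁴.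
expLe : ∀ K {D M} → D ℕ.≤ 16 ℕ.* (K ℕ.* K ℕ.* K ℕ.* K) → 2 ℕ.^ K ℕ.≤ M → ExpLe ¼ D M
expLe K {D} {M} D≤ 2^K≤M q 0≤q q⁴≤ N =
  ℚ.≤-trans (expPartial-bound K q N 0≤q (ℚ.≮⇒≥ λ y<q → ℚ.<-irrefl refl (chain y<q))) (ι-mono 2^K≤M)
  where
  open ℚ.≤-Reasoning
  open +-*-Solver
  y = ι K ℚ.* ½
  0≤y : 0ℚ ℚ.≤ y
  0≤y = *-nonNeg (0≤ι K) 0≤½
  ι⁴ : ι (16 ℕ.* (K ℕ.* K ℕ.* K ℕ.* K)) ≡ ι 16 ℚ.* (ι K ℚ.* ι K ℚ.* ι K ℚ.* ι K)
  ι⁴ = trans (ι-* 16 (K ℕ.* K ℕ.* K ℕ.* K)) (cong (ι 16 ℚ.*_)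
    (trans (ι-* (K ℕ.* K ℕ.* K) K) (cong (ℚ._* ι K)
    (trans (ι-* (K ℕ.* K) K) (cong (ℚ._* ι K) (ι-* K K))))))
  chain : y ℚ.< q → y ℚ.* y ℚ.* (y ℚ.* y) ℚ.< y ℚ.* y ℚ.* (y ℚ.* y)
  chain y<q = begin-strict
    y ℚ.* y ℚ.* (y ℚ.* y)              <⟨ square-mono-< (*-nonNeg 0≤y 0≤y) (square-mono-< 0≤y y<q) ⟩
    q ℚ.* q ℚ.* (q ℚ.* q)              ≡⟨ ℚ.*-assoc (q ℚ.* q) q q ⟨
    q ℚ.* q ℚ.* q ℚ.* q                ≤⟨ q⁴≤ ⟩
    ¼ ℚ.* ¼ ℚ.* ¼ ℚ.* ¼ ℚ.* ι D        ≤⟨ ℚ.*-monoˡ-≤-nonNeg (¼ ℚ.* ¼ ℚ.* ¼ ℚ.* ¼) (ι-mono D≤) ⟩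
    ¼ ℚ.* ¼ ℚ.* ¼ ℚ.* ¼ ℚ.* ι (16 ℕ.* (K ℕ.* K ℕ.* K ℕ.* K)) ≡⟨ cong (¼ ℚ.* ¼ ℚ.* ¼ ℚ.* ¼ ℚ.*_) ι⁴ ⟩
    ¼ ℚ.* ¼ ℚ.* ¼ ℚ.* ¼ ℚ.* (ι 16 ℚ.* (ι K ℚ.* ι K ℚ.* ι K ℚ.* ι K))
      ≡⟨ solve 1 (λ k → con (¼ ℚ.* ¼ ℚ.* ¼ ℚ.* ¼) :* (con (ι 16) :* (k :* k :* k :* k))
                        := k :* con ½ :* (k :* con ½) :* (k :* con ½ :* (k :* con ½))) refl (ι K) ⟩
    y ℚ.* y ℚ.* (y ℚ.* y)              ∎

-- From decision trees to the communication bound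

open import Data.Nat using (ℕ; _*_; _^_; _<_)
open import Data.Rational using (ℚ; 0ℚ) renaming (_<_ to _<ℚ_)

isDegree⇒degree< : ∀ {t} {f : BoolFn t} {d} → IsDegree f d → Degree< (suc d) f
isDegree⇒degree< {f = f} (_ , bound) S d<∣S∣ = fhat≡0⇒coeff≡0 f S
  (decidable-stable (fhat f S ℚ.≟ 0ℚ) λ f̂S≢0 → ℕ.<⇒≱ d<∣S∣ (bound S f̂S≢0))

-- An offset below m takes ℓ + 1 bits and the two mask bits bring a query to ℓ + 3. This is at most
-- 4ℓ⁴ for ℓ ≥ 1, with equality at ℓ = 1; a fourth power is what fits next to d⁴.
cc-bound : ∀ {n t m} (eq : t * m ≡ n) {f : BoolFn t} → Signed f → ∀ {d} → Degree< (suc d) f →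
           ∀ {ℓ} → 0 < ℓ → m < 2 ^ suc ℓ → ∀ {D} → IsCC (patternMatrix eq f) D →
           D ℕ.≤ 16 * (d * ℓ * (d * ℓ) * (d * ℓ) * (d * ℓ))
cc-bound eq {f} sf {d} deg {ℓ@(suc k)} 0<ℓ m< {D} (_ , optimal)
  with Simulation.simulate eq (suc ℓ) (ℕ.<⇒≤ m<) (degree⇒decides d f sf deg)
... | P , computes , depth≤ = begin
  D                                        ≤⟨ optimal P computes ⟩
  depth P                                  ≤⟨ depth≤ ⟩
  queries d * (suc ℓ ℕ.+ 2)                ≤⟨ ℕ.*-mono-≤ (queries-bound d) ℓ+3≤4ℓ⁴ ⟩
  4 * (d * d * d * d) * (4 * (ℓ * ℓ * ℓ * ℓ)) ≡⟨ regroup d ℓ ⟩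
  16 * (d * ℓ * (d * ℓ) * (d * ℓ) * (d * ℓ)) ∎
  where
  open ℕ.≤-Reasoning
  regroup : ∀ d ℓ → 4 * (d * d * d * d) * (4 * (ℓ * ℓ * ℓ * ℓ)) ≡ 16 * (d * ℓ * (d * ℓ) * (d * ℓ) * (d * ℓ))
  regroup = ℕ-Solver.solve-∀
  expand : ∀ k → (suc (suc k) ℕ.+ 2) ℕ.+ (4 * (k * k * k * k) ℕ.+ 16 * (k * k * k) ℕ.+ 24 * (k * k) ℕ.+ 15 * k)
               ≡ 4 * (suc k * suc k * suc k * suc k)
  expand = ℕ-Solver.solve-∀
  ℓ+3≤4ℓ⁴ : suc ℓ ℕ.+ 2 ℕ.≤ 4 * (ℓ * ℓ * ℓ * ℓ)
  ℓ+3≤4ℓ⁴ = subst (suc ℓ ℕ.+ 2 ℕ.≤_) (expand k) (ℕ.m≤m+n (suc ℓ ℕ.+ 2) _)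

theorem11p1 : Σ ℚ λ c → (0ℚ <ℚ c) ×
    ((n t m : ℕ) → 0 < t → t < n → (eq : t * m ≡ n) →
    (f : Vec Bool t → ℤ) → ((z : Vec Bool t) → (f z ≡ + 1) ⊎ (f z ≡ -[1+ 0 ])) →
    (d : ℕ) → IsDegree f d →
    (D : ℕ) → IsCC (patternMatrix eq f) D →
    RankAtLeast (patternMatrix eq f) (m ^ d) × ExpLe c D (m ^ d))
theorem11p1 = ¼ , ℚ.positive⁻¹ ¼ , proof
  where
  proof : (n t m : ℕ) → 0 < t → t < n → (eq : t * m ≡ n) →
    (f : Vec Bool t → ℤ) → ((z : Vec Bool t) → (f z ≡ + 1) ⊎ (f z ≡ -[1+ 0 ])) →
    (d : ℕ) → IsDegree f d →
    (D : ℕ) → IsCC (patternMatrix eq f) D →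
    RankAtLeast (patternMatrix eq f) (m ^ d) × ExpLe ¼ D (m ^ d)
  -- The condition t < n excludes block sizes 0 and 1. With blocks of size 1 the bound m^d would be
  -- 1, although D can be positive.
  proof n t zero 0<t t<n eq = contradiction (subst (t <_) (trans (sym eq) (ℕ.*-zeroʳ t)) t<n) (λ ())
  proof n t 1    0<t t<n eq = contradiction (subst (t <_) (trans (sym eq) (ℕ.*-identityʳ t)) t<n) (ℕ.<-irrefl refl)
  proof n t m@(suc (suc _)) 0<t t<n eq f sf d isDeg@((S , refl , f̂S≢0) , _) D isCC =
    rank-bound eq f S (f̂S≢0 ∘ coeff≡0⇒fhat≡0 f S) , exponential (binary-log m (s≤s z≤n))
    where
    exponential : (Σ ℕ λ ℓ → 2 ^ ℓ ℕ.≤ m × m < 2 ^ suc ℓ) → ExpLe ¼ D (m ^ d)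
    -- As m ≥ 2, its binary logarithm has integer part at least 1.
    exponential (zero , _ , s≤s (s≤s ()))
    -- K = dℓ fits both sides: D ≤ 16K⁴ and 2^K = (2^ℓ)^d ≤ m^d.
    exponential (ℓ@(suc _) , lo , hi) = expLe (d * ℓ) {D} {m ^ d}
      (cc-bound eq sf (isDegree⇒degree< isDeg) (s≤s z≤n) hi isCC) (begin
        2 ^ (d * ℓ)  ≡⟨ cong (2 ^_) (ℕ.*-comm d ℓ) ⟩
        2 ^ (ℓ * d)  ≡⟨ ℕ.^-*-assoc 2 ℓ d ⟨
        (2 ^ ℓ) ^ d  ≤⟨ ℕ.^-monoˡ-≤ d lo ⟩
        m ^ d        ∎)
      where open ℕ.≤-Reasoning
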